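{- Let $s\in\mathbb R$, $h\in\mathbb C\setminus\{0\}$ and $q>0$ real, and let $S_{s,h,q}[n,k]$ be defined through rook placements under the pre-weight rule (see context), with $B_{s,h,q}[n]=\sum_{k=0}^nS_{s,h,q}[n,k]$. Then for all integers $n,k\ge1$, $$S_{s,h,q}[n,k]=\sum_{r=k-1}^{n-1}h^{n-r-1}q^r\genfrac{[}{]}{0pt}{}{n-1}{r}_{q^s}S_{s,h,q}[r,k-1]\prod_{i=0}^{n-r-2}[1+si]_q ,$$ $$B_{s,h,q}[n]=\sum_{r=0}^{n-1}h^{n-r-1}q^r\genfrac{[}{]}{0pt}{}{n-1}{r}_{q^s}B_{s,h,q}[r]\prod_{i=0}^{n-r-2}[1+si]_q ,$$ and for all nonnegative integers $n,m,k$, $$S_{s,h,q}[n+m,k]=\sum_{r=0}^n\sum_{j=0}^mh^{n-r}q^{r(j(1-s)+sm)}\genfrac{[}{]}{0pt}{}{n}{r}_{q^s}S_{s,h,q}[m,j]\,S_{s,h,q}[r,k-j]\prod_{i=0}^{n-r-1}[j(1-s)+sm+si]_q ,$$ $$B_{s,h,q}[n+m]=\sum_{r=0}^n\sum_{j=0}^mh^{n-r}q^{r(j(1-s)+sm)}\genfrac{[}{]}{0pt}{}{n}{r}_{q^s}S_{s,h,q}[m,j]\,B_{s,h,q}[r]\prod_{i=0}^{n-r-1}[j(1-s)+sm+si]_q .$$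
   Context: For $x\in\mathbb R$, $[x]_q=\frac{q^x-1}{q-1}$ if $q\ne1$ and $[x]_1=x$. $\genfrac{[}{]}{0pt}{}{n}{k}_p$ is the Gaussian ($p$-binomial) coefficient, understood as a polynomial in $p$ evaluated at the given value. Let $J_n$ be the Ferrers board outlined by the word $(VU)^n$ ($U$ a horizontal step, $V$ a vertical step): it has $n$ columns and, numbering columns from right to left, column $i$ has $i-1$ cells; the columns are aligned at the top, so that each cell of column $i$ has cells to its left in the same row in all columns $i'>i$. Pre-weight rule: rooks are placed on cells in some chosen columns from right to left, at most one rook per column. Every cell has default pre-weight $1$, and each rook adds $s-1$ to the pre-weight of every cell to its left in its row. Every cell lying above a rook in the same column has weight $1$. A cell not lying above a rook and having pre-weight $p$ has weight $h[p]_q$ if it contains a rook and $q^p$ otherwise. The weight $\omega(\psi)$ of a placement $\psi$ is the product of the weights of all cells. $C^*_k(J_n;s)$ is the set of placements of $k$ rooks on $J_n$ under this rule. For $s\in\mathbb R$, $S_{s,h,q}[n,k]=\sum_{\psi\in C^*_{n-k}(J_n;s)}\omega(\psi)$ for $0\le k\le n$, and $S_{s,h,q}[n,k]=0$ for $k<0$ or $k>n$. (For $s$ a nonnegative integer these are the normal ordering coefficients of $(VU)^n$ when $UV-qVU=hV^s$.) Empty products equal $1$, empty sums equal $0$. -}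

module Defs where

open import Algebra.Bundles using (CommutativeRing)
import Algebra.Construct.DirectProduct as DirectProduct
import Algebra.Properties.Ring as RingProperties
import Algebra.Properties.Semiring.Exp as SemiringExp
import Algebra.Solver.Ring.NaturalCoefficients.Default as SemiringSolver
open import Data.Bool.Base using (if_then_else_)
open import Data.Fin.Base using (Fin; toℕ)
open import Data.Integer.Base using (ℤ; +_; -[1+_])
open import Data.List.Base
  using (List; []; _∷_; allFin; applyUpTo; concatMap; filter; foldr; map; upTo)
open import Data.Maybe.Base using (Maybe; just; nothing)
open import Data.Nat.Base as ℕ using (ℕ; zero; suc)
import Data.Nat.Properties as ℕ
open import Data.Product.Base using (∃; _×_; _,_)
open import Data.Sum.Base using (_⊎_)
open import Level using (Level; _⊔_) renaming (suc to lsuc)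
open import Relation.Binary.Core using (Rel)
open import Relation.Binary.Definitions using (tri<; tri≈; tri>)
open import Relation.Binary.PropositionalEquality.Core as ≡ using ()
import Relation.Binary.Reasoning.Setoid as SetoidReasoning
open import Relation.Binary.Structures using (IsStrictTotalOrder)
open import Relation.Nullary.Decidable.Core using (does)
open import Relation.Nullary.Negation.Core using (¬_)

private variable
  c ℓ : Level

------------------------------------------------------------------------
-- Real and complex numbers

-- The classical axioms of a Dedekind-complete ordered field, which
-- determine ℝ up to isomorphism.  The trichotomy in IsStrictTotalOrder
-- and the field `supremum` are where classical logic enters.
record RealNumbers (c ℓ : Level) : Set (lsuc (c ⊔ ℓ)) where
  infix 4 _<_ _≤_
  infix 8 _⁻¹

  field
    commutativeRing : CommutativeRing c ℓ

  open CommutativeRing commutativeRing public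

  field
    _<_                : Rel Carrier ℓ
    isStrictTotalOrder : IsStrictTotalOrder _≈_ _<_
    0<1                : 0# < 1#
    +-monoˡ-<          : ∀ x {y z} → y < z → y + x < z + x
    *-positive         : ∀ {x y} → 0# < x → 0# < y → 0# < x * y
    -- The value of 0# ⁻¹ is unspecified.
    _⁻¹                : Carrier → Carrier
    ⁻¹-inverseʳ        : ∀ x → ¬ (x ≈ 0#) → x * x ⁻¹ ≈ 1#

  open IsStrictTotalOrder isStrictTotalOrder public
    using (compare; _≟_)

  _≤_ : Rel Carrier ℓ
  x ≤ y = x < y ⊎ x ≈ y

  UpperBound : (Carrier → Set (c ⊔ ℓ)) → Carrier → Set (c ⊔ ℓ)
  UpperBound P u = ∀ x → P x → x ≤ u

  field
    supremum : (P : Carrier → Set (c ⊔ ℓ)) → ∃ P → ∃ (UpperBound P) →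
               ∃ λ u → UpperBound P u × (∀ v → UpperBound P v → u ≤ v)

  fromℕ : ℕ → Carrier
  fromℕ zero    = 0#
  fromℕ (suc n) = 1# + fromℕ n

-- The real power q ^ x for q > 0.  For each q > 0 the axioms determine
-- x ↦ q ^ x uniquely, as the monotone homomorphism from (ℝ , +) to
-- (ℝ , ·) with value q at 1.  Nothing is assumed when q ≤ 0.
record RealPower (ℝ : RealNumbers c ℓ) : Set (c ⊔ ℓ) where
  open RealNumbers ℝ
  infixr 8 _^_

  field
    _^_       : Carrier → Carrier → Carrier
    ^-cong    : ∀ {q r x y} → 0# < q → q ≈ r → x ≈ y → q ^ x ≈ r ^ y
    ^-+-homo  : ∀ {q} → 0# < q → ∀ x y → q ^ (x + y) ≈ q ^ x * q ^ y
    ^-1       : ∀ {q} → 0# < q → q ^ 1# ≈ q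
    1^        : ∀ x → 1# ^ x ≈ 1#
    ^-mono-<  : ∀ {q x y} → 1# < q → x < y → q ^ x < q ^ y
    ^-anti-<  : ∀ {q x y} → 0# < q → q < 1# → x < y → q ^ y < q ^ x

module Complex (ℝ : RealNumbers c ℓ) where
  open RealNumbers ℝ

  open RingProperties ring using (-0#≈0#; -1*x≈-x)
  open SemiringSolver commutativeSemiring
    using (solve; _:=_; _:+_; _:*_)

  -- (a , b) stands for a + b i.
  ℂ : Set c
  ℂ = Carrier × Carrier

  infixl 7 _*ᶜ_

  _*ᶜ_ : ℂ → ℂ → ℂ
  (a , b) *ᶜ (a′ , b′) = (a * a′ - b * b′) , (a * b′ + b * a′)

  ι : Carrier → ℂ
  ι x = x , 0#

  complexRing : CommutativeRing c ℓ
  complexRing = record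
    { Carrier = ℂ
    ; _≈_ = A._≈_
    ; _+_ = A._∙_
    ; _*_ = _*ᶜ_
    ; -_  = A._⁻¹
    ; 0#  = A.ε
    ; 1#  = ι 1#
    ; isCommutativeRing = record
      { isRing = record
        { +-isAbelianGroup = A.isAbelianGroup
        ; *-cong = λ (a≈ , b≈) (a′≈ , b′≈) →
            +-cong (*-cong a≈ a′≈) (-‿cong (*-cong b≈ b′≈)) ,
            +-cong (*-cong a≈ b′≈) (*-cong b≈ a′≈)
        ; *-assoc = assoc
        ; *-identity = identityˡ , λ z → A.trans (comm z (ι 1#)) (identityˡ z)
        ; distrib = distribˡᶜ , λ x y z →
            A.trans (comm (y A.∙ z) x)
              (A.trans (distribˡᶜ x y z) (A.∙-cong (comm x y) (comm x z)))
        }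
      ; *-comm = comm
      }
    }
    where
    module A = CommutativeRing (DirectProduct.commutativeRing commutativeRing commutativeRing)
      using () renaming
        ( _≈_ to _≈_; _+_ to _∙_; -_ to _⁻¹; 0# to ε; trans to trans
        ; +-cong to ∙-cong; +-isAbelianGroup to isAbelianGroup )

    comm : ∀ x y → (x *ᶜ y) A.≈ (y *ᶜ x)
    comm (a , b) (a′ , b′) =
      +-cong (*-comm a a′) (-‿cong (*-comm b b′)) ,
      trans (+-comm _ _) (+-cong (*-comm b a′) (*-comm a b′))

    identityˡ : ∀ x → (ι 1# *ᶜ x) A.≈ x
    identityˡ (a , b) =
      trans (+-cong (*-identityˡ a) (trans (-‿cong (zeroˡ b)) -0#≈0#)) (+-identityʳ a) ,
      trans (+-cong (*-identityˡ b) (zeroˡ a)) (+-identityʳ b)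

    -- The solver works over commutative semirings, so subtraction is
    -- first rewritten as addition of a multiple of - 1#.
    sub : ∀ x y → x - y ≈ x + - 1# * y
    sub x y = +-congˡ (sym (-1*x≈-x y))

    assoc : ∀ x y z → ((x *ᶜ y) *ᶜ z) A.≈ (x *ᶜ (y *ᶜ z))
    assoc (a , b) (d , e) (f , g) =
      trans (trans (sub _ _) (+-congʳ (*-congʳ (sub _ _))))
        (trans
          (solve 7 (λ ε a b d e f g →
            ((a :* d :+ ε :* (b :* e)) :* f :+ ε :* ((a :* e :+ b :* d) :* g))
            := (a :* (d :* f :+ ε :* (e :* g)) :+ ε :* (b :* (d :* g :+ e :* f))))
            refl (- 1#) a b d e f g)
          (sym (trans (sub _ _) (+-congʳ (*-congˡ (sub _ _)))))) ,
      trans (+-congʳ (*-congʳ (sub _ _)))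
        (trans
          (solve 7 (λ ε a b d e f g →
            ((a :* d :+ ε :* (b :* e)) :* g :+ (a :* e :+ b :* d) :* f)
            := (a :* (d :* g :+ e :* f) :+ b :* (d :* f :+ ε :* (e :* g))))
            refl (- 1#) a b d e f g)
          (sym (+-congˡ (*-congˡ (sub _ _)))))

    distribˡᶜ : ∀ x y z → (x *ᶜ (y A.∙ z)) A.≈ ((x *ᶜ y) A.∙ (x *ᶜ z))
    distribˡᶜ (a , b) (d , e) (f , g) =
      trans (sub _ _)
        (trans
          (solve 7 (λ ε a b d e f g →
            (a :* (d :+ f) :+ ε :* (b :* (e :+ g)))
            := ((a :* d :+ ε :* (b :* e)) :+ (a :* f :+ ε :* (b :* g))))
            refl (- 1#) a b d e f g)
          (sym (+-cong (sub _ _) (sub _ _)))) ,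
      solve 6 (λ a b d e f g →
        (a :* (e :+ g) :+ b :* (d :+ f))
        := ((a :* e :+ b :* d) :+ (a :* g :+ b :* f))) refl a b d e f g

  open CommutativeRing complexRing public
    using () renaming (_≈_ to infix 4 _≈ᶜ_; 0# to 0ᶜ; 1# to 1ᶜ)
  open SemiringExp (CommutativeRing.semiring complexRing) public
    using () renaming (_^_ to infixr 8 _^ᶜ_)

------------------------------------------------------------------------
-- Finite sums and products

-- The list a , a + 1 , … , b - 1; it is empty when b ≤ a.
range : ℕ → ℕ → List ℕ
range a b = applyUpTo (a ℕ.+_) (b ℕ.∸ a)

module BigOperators (R : CommutativeRing c ℓ) where
  open CommutativeRing R

  ∑ ∏ : ∀ {a} {A : Set a} → List A → (A → Carrier) → Carrier
  ∑ xs f = foldr (λ x acc → f x + acc) 0# xs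
  ∏ xs f = foldr (λ x acc → f x * acc) 1# xs

  infix 6 ∑ ∏
  syntax ∑ xs (λ x → e) = ∑[ x ∈ xs ] e
  syntax ∏ xs (λ x → e) = ∏[ x ∈ xs ] e

------------------------------------------------------------------------
-- Gaussian binomial coefficients

module Gaussian (R : CommutativeRing c ℓ) where
  open CommutativeRing R hiding (zero)
  open SemiringExp semiring using (_^_)

  -- The value at p of the Gaussian polynomial, by its Pascal recurrence;
  -- gaussian-factorial is the usual quotient formula
  -- [ k + m ]! / ([ k ]! [ m ]!), without division.
  gaussian : Carrier → ℕ → ℕ → Carrier
  gaussian p n       zero    = 1#
  gaussian p zero    (suc k) = 0#
  gaussian p (suc n) (suc k) = gaussian p n k + p ^ suc k * gaussian p n (suc k)

  -- 1 + p + … + p ^ (n - 1)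
  [_]⟨_⟩ : ℕ → Carrier → Carrier
  [ zero  ]⟨ p ⟩ = 0#
  [ suc n ]⟨ p ⟩ = 1# + p * [ n ]⟨ p ⟩

  [_]!⟨_⟩ : ℕ → Carrier → Carrier
  [ zero  ]!⟨ p ⟩ = 1#
  [ suc n ]!⟨ p ⟩ = [ suc n ]⟨ p ⟩ * [ n ]!⟨ p ⟩

  private
    open SetoidReasoning setoid
    open SemiringSolver commutativeSemiring
      using (solve; _:=_; _:+_; _:*_)

    gaussian-> : ∀ p {n k} → n ℕ.< k → gaussian p n k ≈ 0#
    gaussian-> p {zero}  {suc k} _ = refl
    gaussian-> p {suc n} {suc k} (ℕ.s≤s n<k) = begin
      gaussian p n k + p ^ suc k * gaussian p n (suc k)
        ≈⟨ +-cong (gaussian-> p n<k) (*-congˡ (gaussian-> p (ℕ.m<n⇒m<1+n n<k))) ⟩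
      0# + p ^ suc k * 0#
        ≈⟨ trans (+-identityˡ _) (zeroʳ _) ⟩
      0# ∎

    []-+ : ∀ p k m → [ k ]⟨ p ⟩ + p ^ k * [ m ]⟨ p ⟩ ≈ [ k ℕ.+ m ]⟨ p ⟩
    []-+ p zero    m = trans (+-identityˡ _) (*-identityˡ _)
    []-+ p (suc k) m = begin
      (1# + p * [ k ]⟨ p ⟩) + p ^ suc k * [ m ]⟨ p ⟩
        ≈⟨ +-assoc _ _ _ ⟩
      1# + (p * [ k ]⟨ p ⟩ + p ^ suc k * [ m ]⟨ p ⟩)
        ≈⟨ +-congˡ (+-congˡ (*-assoc _ _ _)) ⟩
      1# + (p * [ k ]⟨ p ⟩ + p * (p ^ k * [ m ]⟨ p ⟩))
        ≈⟨ +-congˡ (distribˡ _ _ _) ⟨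
      1# + p * ([ k ]⟨ p ⟩ + p ^ k * [ m ]⟨ p ⟩)
        ≈⟨ +-congˡ (*-congˡ ([]-+ p k m)) ⟩
      1# + p * [ k ℕ.+ m ]⟨ p ⟩ ∎

    rearrange : ∀ g g′ P a A b B →
      (g + P * g′) * ((a * A) * (b * B)) ≈
      a * (g * (A * (b * B))) + P * b * (g′ * ((a * A) * B))
    rearrange = solve 7 (λ g g′ P a A b B →
      ((g :+ P :* g′) :* ((a :* A) :* (b :* B)))
      := (a :* (g :* (A :* (b :* B))) :+ P :* b :* (g′ :* ((a :* A) :* B)))) refl

  gaussian-factorial : ∀ p k m →
    gaussian p (k ℕ.+ m) k * ([ k ]!⟨ p ⟩ * [ m ]!⟨ p ⟩) ≈ [ k ℕ.+ m ]!⟨ p ⟩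
  gaussian-factorial p zero    m = trans (*-identityˡ _) (*-identityˡ _)
  gaussian-factorial p (suc k) zero = begin
    (gaussian p (k ℕ.+ 0) k + p ^ suc k * gaussian p (k ℕ.+ 0) (suc k))
      * ([ suc k ]!⟨ p ⟩ * 1#)
      ≈⟨ *-congʳ (+-congˡ (*-congˡ (gaussian-> p (ℕ.s≤s (ℕ.≤-reflexive (ℕ.+-identityʳ k)))))) ⟩
    (gaussian p (k ℕ.+ 0) k + p ^ suc k * 0#) * ([ suc k ]!⟨ p ⟩ * 1#)
      ≈⟨ *-congʳ (trans (+-congˡ (zeroʳ _)) (+-identityʳ _)) ⟩
    gaussian p (k ℕ.+ 0) k * (([ suc k ]⟨ p ⟩ * [ k ]!⟨ p ⟩) * 1#)
      ≈⟨ solve 4 (λ g a A B → (g :* ((a :* A) :* B)) := (a :* (g :* (A :* B)))) refl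
           (gaussian p (k ℕ.+ 0) k) [ suc k ]⟨ p ⟩ [ k ]!⟨ p ⟩ 1# ⟩
    [ suc k ]⟨ p ⟩ * (gaussian p (k ℕ.+ 0) k * ([ k ]!⟨ p ⟩ * 1#))
      ≈⟨ *-cong (reflexive (≡.cong (λ j → [ suc j ]⟨ p ⟩) (≡.sym (ℕ.+-identityʳ k))))
                (gaussian-factorial p k zero) ⟩
    [ suc k ℕ.+ 0 ]!⟨ p ⟩ ∎
  gaussian-factorial p (suc k) (suc m) = begin
    (g + p ^ suc k * g′) * ((a * A) * (b * B))
      ≈⟨ rearrange g g′ (p ^ suc k) a A b B ⟩
    a * (g * (A * (b * B))) + p ^ suc k * b * (g′ * ((a * A) * B))
      ≈⟨ +-cong (*-congˡ (gaussian-factorial p k (suc m))) (*-congˡ step) ⟩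
    a * F + p ^ suc k * b * F
      ≈⟨ distribʳ _ _ _ ⟨
    (a + p ^ suc k * b) * F
      ≈⟨ *-congʳ ([]-+ p (suc k) (suc m)) ⟩
    [ suc k ℕ.+ suc m ]!⟨ p ⟩ ∎
    where
    g g′ a A b B F : Carrier
    g  = gaussian p (k ℕ.+ suc m) k
    g′ = gaussian p (k ℕ.+ suc m) (suc k)
    a  = [ suc k ]⟨ p ⟩
    A  = [ k ]!⟨ p ⟩
    b  = [ suc m ]⟨ p ⟩
    B  = [ m ]!⟨ p ⟩
    F  = [ k ℕ.+ suc m ]!⟨ p ⟩

    step : g′ * ((a * A) * B) ≈ F
    step = ≡.subst
      (λ j → gaussian p j (suc k) * ((a * A) * B) ≈ [ j ]!⟨ p ⟩)
      (≡.sym (ℕ.+-suc k m)) (gaussian-factorial p (suc k) m)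

------------------------------------------------------------------------
-- Rook placements on the board Jₙ

-- Columns are listed from right to left, so ψ ▹ x adds a leftmost column
-- to a placement ψ on J n.  As column i (counting from 1) has i - 1
-- cells, this is column n + 1, with n cells.  Rows are numbered 0 , 1 , …
-- from the top, where the columns are aligned.  The new column has no
-- rook if x is nothing, and a rook in row ρ if x is just ρ.
data Placement : ℕ → Set where
  []  : Placement 0
  _▹_ : ∀ {n} → Placement n → Maybe (Fin n) → Placement (suc n)

infixl 5 _▹_

rooks : ∀ {n} → Placement n → ℕ
rooks []            = 0
rooks (ψ ▹ nothing) = rooks ψ
rooks (ψ ▹ just _)  = suc (rooks ψ)

placements : ∀ n → List (Placement n)
placements zero    = [] ∷ []
placements (suc n) =
  concatMap (λ ψ → map (ψ ▹_) (nothing ∷ map just (allFin n))) (placements n)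

C* : ∀ n → ℕ → List (Placement n)
C* n k = filter (λ ψ → rooks ψ ℕ.≟ k) (placements n)

module RookNumbers (ℝ : RealNumbers c ℓ) (power : RealPower ℝ)
                   (s : RealNumbers.Carrier ℝ)
                   (h : Complex.ℂ ℝ)
                   (q : RealNumbers.Carrier ℝ) where
  open RealNumbers ℝ
  open RealPower power
  open Complex ℝ
  open BigOperators complexRing

  [_]q : Carrier → Carrier
  [ x ]q = if does (q ≟ 1#) then x else (q ^ x - 1#) * (q - 1#) ⁻¹

  -- The pre-weight, once the rooks of ψ are placed, of the cells in row r
  -- lying to the left of all columns of ψ.
  preWeight : ∀ {n} → Placement n → ℕ → Carrier
  preWeight []            r = 1#
  preWeight (ψ ▹ nothing) r = preWeight ψ r
  preWeight (ψ ▹ just ρ)  r =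
    if does (toℕ ρ ℕ.≟ r) then preWeight ψ r + (s - 1#) else preWeight ψ r

  -- The weight of the cell in row r and pre-weight p of a column with
  -- rook (if any) given by the first argument.
  cellWeight : ∀ {n} → Maybe (Fin n) → Fin n → Carrier → ℂ
  cellWeight nothing  r p = ι (q ^ p)
  cellWeight (just ρ) r p with ℕ.<-cmp (toℕ r) (toℕ ρ)
  ... | tri< _ _ _ = 1ᶜ
  ... | tri≈ _ _ _ = h *ᶜ ι [ p ]q
  ... | tri> _ _ _ = ι (q ^ p)

  ω : ∀ {n} → Placement n → ℂ
  ω []            = 1ᶜ
  ω (_▹_ {n} ψ x) =
    ω ψ *ᶜ (∏[ r ∈ allFin n ] cellWeight x r (preWeight ψ (toℕ r)))

  S : ℕ → ℤ → ℂ
  S n (+ k)    =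
    if does (k ℕ.≤? n) then (∑[ ψ ∈ C* n (n ℕ.∸ k) ] ω ψ) else 0ᶜ
  S n -[1+ k ] = 0ᶜ

  B : ℕ → ℂ
  B n = ∑[ k ∈ upTo (suc n) ] S n (+ k)

{-# OPTIONS --safe #-}

-- For a weight w : ℕ → ℂ consider the sum of ω ψ · w (number of columns
-- of ψ without a rook) over all placements ψ on Jₙ; the choice w = δ k
-- gives S[n,k] and w = 1 gives B[n].  A new column of total pre-weight x
-- contributes q ^ x without a rook and h [x]_q when summed over all
-- positions of a rook, because [x + y]_q = [x]_q + q ^ x [y]_q.  Here
-- x = j (1 - s) + s m for column m + 1 if j of the first m columns have no
-- rook, and this is additive in (j, m).  Hence the sum for n + m columns
-- is a composite of the sum for m columns with one for n columns whose
-- rows carry the extra pre-weight a = j (1 - s) + s m, and splitting a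
-- off by the law for [x + y]_q expresses the latter by the sums for
-- r ≤ n columns, with coefficients that obey the Pascal rule of the
-- Gaussian binomials.  The case m = 1 gives the first two identities.
module Submission where

open import Algebra.Bundles using (CommutativeRing)
import Algebra.Properties.Ring as RingProperties
import Algebra.Properties.Semiring.Exp as SemiringExp
import Algebra.Solver.Ring.NaturalCoefficients.Default as SemiringSolver
open import Data.Bool.Base using (true; false; if_then_else_)
open import Data.Fin.Base using (Fin; zero; suc; toℕ)
import Data.Fin.Properties as Fin
open import Data.Integer.Base as ℤ using (+_)
import Data.Integer.Properties as ℤ
open import Data.List.Base
  using (List; []; _∷_; [_]; _++_; _∷ʳ_; allFin; concatMap; filter; map; upTo)
open import Data.List.Membership.Propositional using (_∈_)
open import Data.List.Membership.Propositional.Properties using (∈-upTo⁻)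
import Data.List.Properties as List
open import Data.List.Relation.Unary.Any using (here; there)
open import Data.Maybe.Base using (Maybe; just; nothing)
open import Data.Nat.Base as ℕ using (ℕ; zero; suc; _∸_)
import Data.Nat.Properties as ℕ
open import Data.Product.Base using (_×_; _,_)
open import Function.Base using (_∘_; id)
open import Level using (Level; _⊔_)
open import Relation.Binary.Definitions using (tri<; tri≈; tri>)
open import Relation.Binary.PropositionalEquality.Core as ≡ using (_≡_; _≢_)
import Relation.Binary.Reasoning.Setoid as SetoidReasoning
open import Relation.Binary.Structures using (IsStrictTotalOrder)
open import Relation.Nullary.Decidable using (does; yes; no; dec-true; dec-false)
open import Relation.Nullary.Negation.Core using (¬_; contradiction)
open import Relation.Unary using (Pred; Decidable)
open import Defs

private variable
  c ℓ c′ ℓ′ ℓ₁ ℓ₂ : Level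
  A A′ : Set ℓ₁

-- Finite sums and products, and the Kronecker delta.

module BigOperatorProperties (R : CommutativeRing c ℓ) where
  open CommutativeRing R hiding (zero)
  open BigOperators R
  open SetoidReasoning setoid
  open SemiringSolver commutativeSemiring
    using (solve; _:=_; _:+_; _:*_)

  ∑-cong : ∀ {f g : A → Carrier} xs → (∀ {x} → x ∈ xs → f x ≈ g x) →
           ∑ xs f ≈ ∑ xs g
  ∑-cong []       f≈g = refl
  ∑-cong (x ∷ xs) f≈g = +-cong (f≈g (here ≡.refl)) (∑-cong xs (f≈g ∘ there))

  ∏-cong : ∀ {f g : A → Carrier} xs → (∀ x → f x ≈ g x) → ∏ xs f ≈ ∏ xs g
  ∏-cong []       f≈g = refl
  ∏-cong (x ∷ xs) f≈g = *-cong (f≈g x) (∏-cong xs f≈g)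

  ∑-map : ∀ (f : A′ → Carrier) (g : A → A′) xs → ∑ (map g xs) f ≈ ∑ xs (f ∘ g)
  ∑-map f g []       = refl
  ∑-map f g (x ∷ xs) = +-congˡ (∑-map f g xs)

  ∏-map : ∀ (f : A′ → Carrier) (g : A → A′) xs → ∏ (map g xs) f ≈ ∏ xs (f ∘ g)
  ∏-map f g []       = refl
  ∏-map f g (x ∷ xs) = *-congˡ (∏-map f g xs)

  ∑-++ : ∀ (f : A → Carrier) xs ys → ∑ (xs ++ ys) f ≈ ∑ xs f + ∑ ys f
  ∑-++ f []       ys = sym (+-identityˡ _)
  ∑-++ f (x ∷ xs) ys = trans (+-congˡ (∑-++ f xs ys)) (sym (+-assoc _ _ _))

  ∑-∷ʳ : ∀ (f : A → Carrier) xs x → ∑ (xs ∷ʳ x) f ≈ ∑ xs f + f x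
  ∑-∷ʳ f xs x = trans (∑-++ f xs [ x ]) (+-congˡ (+-identityʳ _))

  ∏-∷ʳ : ∀ (f : A → Carrier) xs x → ∏ (xs ∷ʳ x) f ≈ ∏ xs f * f x
  ∏-∷ʳ f []       x = *-comm _ _
  ∏-∷ʳ f (y ∷ xs) x = trans (*-congˡ (∏-∷ʳ f xs x)) (sym (*-assoc _ _ _))

  ∑-concatMap : ∀ (f : A′ → Carrier) (g : A → List A′) xs →
                ∑ (concatMap g xs) f ≈ (∑[ x ∈ xs ] ∑ (g x) f)
  ∑-concatMap f g []       = refl
  ∑-concatMap f g (x ∷ xs) =
    trans (∑-++ f (g x) (concatMap g xs)) (+-congˡ (∑-concatMap f g xs))

  ∑-zero : ∀ (xs : List A) → (∑[ x ∈ xs ] 0#) ≈ 0#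
  ∑-zero []       = refl
  ∑-zero (x ∷ xs) = trans (+-identityˡ _) (∑-zero xs)

  ∑-+ : ∀ (f g : A → Carrier) xs → (∑[ x ∈ xs ] (f x + g x)) ≈ ∑ xs f + ∑ xs g
  ∑-+ f g []       = sym (+-identityˡ _)
  ∑-+ f g (x ∷ xs) = trans (+-congˡ (∑-+ f g xs))
    (solve 4 (λ a b c d → a :+ b :+ (c :+ d) := a :+ c :+ (b :+ d)) refl
      (f x) (g x) (∑ xs f) (∑ xs g))

  ∑-*ˡ : ∀ x (f : A → Carrier) xs → (∑[ y ∈ xs ] x * f y) ≈ x * ∑ xs f
  ∑-*ˡ x f []       = sym (zeroʳ _)
  ∑-*ˡ x f (y ∷ xs) = trans (+-congˡ (∑-*ˡ x f xs)) (sym (distribˡ _ _ _))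

  ∑-filter : ∀ {P : Pred A ℓ₂} (P? : Decidable P) (f : A → Carrier) xs →
    ∑ (filter P? xs) f ≈ (∑[ x ∈ xs ] f x * (if does (P? x) then 1# else 0#))
  ∑-filter P? f []       = refl
  ∑-filter P? f (x ∷ xs) with P? x
  ... | yes _ = +-cong (sym (*-identityʳ _)) (∑-filter P? f xs)
  ... | no  _ = trans (∑-filter P? f xs)
                  (sym (trans (+-congʳ (zeroʳ _)) (+-identityˡ _)))

  ∑-upTo-suc : ∀ (f : ℕ → Carrier) n →
               ∑ (upTo (suc n)) f ≈ f 0 + ∑ (upTo n) (f ∘ suc)
  ∑-upTo-suc f n = +-congˡ (trans
    (reflexive (≡.cong (λ xs → ∑ xs f) (≡.sym (List.map-upTo suc n))))
    (∑-map f suc (upTo n)))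

  ∑-upTo-sucʳ : ∀ (f : ℕ → Carrier) n →
                ∑ (upTo (suc n)) f ≈ ∑ (upTo n) f + f n
  ∑-upTo-sucʳ f n = trans
    (reflexive (≡.cong (λ xs → ∑ xs f) (≡.sym (List.upTo-∷ʳ n))))
    (∑-∷ʳ f (upTo n) n)

  ∏-upTo-sucʳ : ∀ (f : ℕ → Carrier) n →
                ∏ (upTo (suc n)) f ≈ ∏ (upTo n) f * f n
  ∏-upTo-sucʳ f n = trans
    (reflexive (≡.cong (λ xs → ∏ xs f) (≡.sym (List.upTo-∷ʳ n))))
    (∏-∷ʳ f (upTo n) n)

  -- Needed because the first identity sums from `r = k - 1`, whereas its proof produces a sum from
  -- `0` whose additional terms vanish.
  ∑-range : ∀ (f : ℕ → Carrier) a b → (∀ r → r ℕ.< a → f r ≈ 0#) →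
            ∑ (range a b) f ≈ ∑ (upTo b) f
  ∑-range f zero    b       _   = refl
  ∑-range f (suc a) zero    _   = refl
  ∑-range f (suc a) (suc b) f≈0 = begin
    ∑ (range (suc a) (suc b)) f
      ≡⟨ ≡.cong (λ xs → ∑ xs f) (List.map-applyUpTo (a ℕ.+_) suc (b ∸ a)) ⟨
    ∑ (map suc (range a b)) f
      ≈⟨ ∑-map f suc (range a b) ⟩
    ∑ (range a b) (f ∘ suc)
      ≈⟨ ∑-range (f ∘ suc) a b (λ r r<a → f≈0 (suc r) (ℕ.s≤s r<a)) ⟩
    ∑ (upTo b) (f ∘ suc)
      ≈⟨ +-identityˡ _ ⟨
    0# + ∑ (upTo b) (f ∘ suc)
      ≈⟨ +-congʳ (f≈0 0 ℕ.z<s) ⟨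
    f 0 + ∑ (upTo b) (f ∘ suc)
      ≈⟨ ∑-upTo-suc f b ⟨
    ∑ (upTo (suc b)) f ∎

  -- Built on `≡ᵇ`, so that common successors cancel by computation and the indicator that
  -- `∑-filter` yields for `ℕ.≟` is literally a `δ`.
  δ : ℕ → ℕ → Carrier
  δ j k = if j ℕ.≡ᵇ k then 1# else 0#

  δ-≡ : ∀ {j k} → j ≡ k → δ j k ≈ 1#
  δ-≡ {zero}  ≡.refl = refl
  δ-≡ {suc j} ≡.refl = δ-≡ {j} ≡.refl

  δ-≢ : ∀ {j k} → j ≢ k → δ j k ≈ 0#
  δ-≢ {zero}  {zero}  j≢k = contradiction ≡.refl j≢k
  δ-≢ {zero}  {suc k} j≢k = refl
  δ-≢ {suc j} {zero}  j≢k = refl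
  δ-≢ {suc j} {suc k} j≢k = δ-≢ (j≢k ∘ ≡.cong suc)

  δ-+ : ∀ i j k → δ (i ℕ.+ j) (i ℕ.+ k) ≡ δ j k
  δ-+ zero    j k = ≡.refl
  δ-+ (suc i) j k = δ-+ i j k

  δ-sym : ∀ j k → δ j k ≡ δ k j
  δ-sym zero    zero    = ≡.refl
  δ-sym zero    (suc k) = ≡.refl
  δ-sym (suc j) zero    = ≡.refl
  δ-sym (suc j) (suc k) = δ-sym j k

  δ-⇔ : ∀ {i j k l} → (i ≡ j → k ≡ l) → (k ≡ l → i ≡ j) → δ i j ≈ δ k l
  δ-⇔ {i} {j} to from with i ℕ.≟ j
  ... | yes i≡j = trans (δ-≡ i≡j) (sym (δ-≡ (to i≡j)))
  ... | no  i≢j = trans (δ-≢ i≢j) (sym (δ-≢ (i≢j ∘ from)))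

  ∑-allFin-suc : ∀ n (f : Fin (suc n) → Carrier) →
                 ∑ (allFin (suc n)) f ≈ f zero + ∑ (allFin n) (f ∘ suc)
  ∑-allFin-suc n f = +-congˡ (trans
    (reflexive (≡.cong (λ xs → ∑ xs f) (≡.sym (List.map-tabulate id suc))))
    (∑-map f suc (allFin n)))

  ∏-allFin-suc : ∀ n (f : Fin (suc n) → Carrier) →
                 ∏ (allFin (suc n)) f ≈ f zero * ∏ (allFin n) (f ∘ suc)
  ∏-allFin-suc n f = *-congˡ (trans
    (reflexive (≡.cong (λ xs → ∏ xs f) (≡.sym (List.map-tabulate id suc))))
    (∏-map f suc (allFin n)))

  ∑-allFin-toℕ : ∀ n (f : ℕ → Carrier) → ∑ (allFin n) (f ∘ toℕ) ≈ ∑ (upTo n) f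
  ∑-allFin-toℕ zero    f = refl
  ∑-allFin-toℕ (suc n) f = trans (∑-allFin-suc n (f ∘ toℕ))
    (trans (+-congˡ (∑-allFin-toℕ n (f ∘ suc))) (sym (∑-upTo-suc f n)))

  ∑-δ : ∀ (f : ℕ → Carrier) {j n} → j ℕ.< n →
        (∑[ i ∈ upTo n ] f i * δ i j) ≈ f j
  ∑-δ f {zero} {suc n} _ = begin
    (∑[ i ∈ upTo (suc n) ] f i * δ i 0)
      ≈⟨ ∑-upTo-suc _ n ⟩
    f 0 * 1# + (∑[ i ∈ upTo n ] f (suc i) * 0#)
      ≈⟨ +-cong (*-identityʳ _) (∑-cong (upTo n) (λ _ → zeroʳ _)) ⟩
    f 0 + (∑[ i ∈ upTo n ] 0#)
      ≈⟨ trans (+-congˡ (∑-zero (upTo n))) (+-identityʳ _) ⟩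
    f 0 ∎
  ∑-δ f {suc j} {suc n} (ℕ.s≤s j<n) = begin
    (∑[ i ∈ upTo (suc n) ] f i * δ i (suc j))
      ≈⟨ ∑-upTo-suc _ n ⟩
    f 0 * 0# + (∑[ i ∈ upTo n ] f (suc i) * δ i j)
      ≈⟨ +-cong (zeroʳ _) (∑-δ (f ∘ suc) j<n) ⟩
    0# + f (suc j)
      ≈⟨ +-identityˡ _ ⟩
    f (suc j) ∎

-- Gaussian binomials and their second Pascal rule.

module GaussianProperties (R : CommutativeRing c ℓ) where
  open CommutativeRing R hiding (zero)
  open SemiringExp semiring using (_^_)
  open Gaussian R using (gaussian)
  open SetoidReasoning setoid
  open SemiringSolver commutativeSemiring
    using (solve; _:=_; _:+_; _:*_; con)

  gaussian-> : ∀ p {n k} → n ℕ.< k → gaussian p n k ≈ 0#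
  gaussian-> p {zero}  {suc k} _ = refl
  gaussian-> p {suc n} {suc k} (ℕ.s≤s n<k) = trans
    (+-cong (gaussian-> p n<k) (*-congˡ (gaussian-> p (ℕ.m<n⇒m<1+n n<k))))
    (trans (+-identityˡ _) (zeroʳ _))

  -- The mirror image of the defining rule, with the power of `p` on the other entry. Expanding both
  -- entries by induction, the cross terms agree because `p ^ (k + 2) * p ^ d` equals
  -- `p ^ (d + 1) * p ^ (k + 1)`. The parameter `d` stands for `n - k` and avoids truncated
  -- subtraction.
  gaussian-pascalʳ : ∀ p n k d → k ℕ.+ d ≡ n →
    gaussian p (suc n) (suc k) ≈ p ^ d * gaussian p n k + gaussian p n (suc k)
  gaussian-pascalʳ p n k zero k+0≡n = begin
    gaussian p n k + p ^ suc k * gaussian p n (suc k)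
      ≈⟨ +-congˡ (trans (*-congˡ g≈0) (zeroʳ _)) ⟩
    gaussian p n k + 0#
      ≈⟨ +-cong (*-identityˡ _) g≈0 ⟨
    1# * gaussian p n k + gaussian p n (suc k) ∎
    where
    g≈0 : gaussian p n (suc k) ≈ 0#
    g≈0 = gaussian-> p (ℕ.s≤s (ℕ.≤-reflexive
            (≡.trans (≡.sym k+0≡n) (ℕ.+-identityʳ k))))
  gaussian-pascalʳ p (suc n) zero (suc d) ≡.refl = begin
    1# + p ^ 1 * gaussian p (suc n) 1
      ≈⟨ +-congˡ (*-congˡ (gaussian-pascalʳ p n zero d ≡.refl)) ⟩
    1# + p ^ 1 * (p ^ d * 1# + gaussian p n 1)
      ≈⟨ solve 3 (λ p x g →
           con 1 :+ (p :* con 1) :* (x :* con 1 :+ g)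
           := (p :* x) :* con 1 :+ (con 1 :+ (p :* con 1) :* g))
         refl p (p ^ d) (gaussian p n 1) ⟩
    p ^ suc d * 1# + (1# + p ^ 1 * gaussian p n 1) ∎
  gaussian-pascalʳ p (suc n) (suc k) (suc d) k+d≡n = begin
    gaussian p (suc n) (suc k) + p ^ suc (suc k) * gaussian p (suc n) (suc (suc k))
      ≈⟨ +-cong (gaussian-pascalʳ p n k (suc d) (ℕ.suc-injective k+d≡n))
           (*-congˡ (gaussian-pascalʳ p n (suc k) d
             (≡.trans (≡.sym (ℕ.+-suc k d)) (ℕ.suc-injective k+d≡n)))) ⟩
    p ^ suc d * g₀ + g₁ + p ^ suc (suc k) * (p ^ d * g₁ + g₂)
      ≈⟨ solve 6 (λ p x y g₀ g₁ g₂ →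
           p :* x :* g₀ :+ g₁ :+ (p :* y) :* (x :* g₁ :+ g₂)
           := (p :* x) :* (g₀ :+ y :* g₁) :+ (g₁ :+ (p :* y) :* g₂))
         refl p (p ^ d) (p ^ suc k) g₀ g₁ g₂ ⟩
    p ^ suc d * (g₀ + p ^ suc k * g₁) + (g₁ + p ^ suc (suc k) * g₂) ∎
    where
    g₀ g₁ g₂ : Carrier
    g₀ = gaussian p n k
    g₁ = gaussian p n (suc k)
    g₂ = gaussian p n (suc (suc k))

-- E x stands for q ^ x and Q x for [ x ]_q, embedded in the complex numbers.
record QExponential (ℝ : RealNumbers c ℓ) (R : CommutativeRing c′ ℓ′) :
                    Set (c ⊔ ℓ ⊔ c′ ⊔ ℓ′) where
  private module X = RealNumbers ℝ
  open CommutativeRing R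

  field
    E Q    : X.Carrier → Carrier
    E-cong : ∀ {x y} → x X.≈ y → E x ≈ E y
    Q-cong : ∀ {x y} → x X.≈ y → Q x ≈ Q y
    E-0    : E X.0# ≈ 1#
    E-+    : ∀ x y → E (x X.+ y) ≈ E x * E y
    Q-0    : Q X.0# ≈ 0#
    Q-+    : ∀ x y → Q (x X.+ y) ≈ Q x + E x * Q y

-- Weighted sums over columns, for an abstract q-exponential.

module Columns
  (ℝ : RealNumbers c ℓ) (R : CommutativeRing c′ ℓ′) (expo : QExponential ℝ R)
  (s : RealNumbers.Carrier ℝ) (h : CommutativeRing.Carrier R)
  where

  open CommutativeRing R hiding (zero)
  open QExponential expo
  open BigOperators R
  open BigOperatorProperties R
  open Gaussian R using (gaussian)
  open GaussianProperties R
  open SemiringExp semiring using (_^_)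
  open SetoidReasoning setoid
  open SemiringSolver commutativeSemiring
    using (solve; _:=_; _:+_; _:*_; con)
  private
    module X = RealNumbers ℝ
    module XS = SemiringSolver X.commutativeSemiring

  -- This is `m + (m - j) (s - 1)`: each of `m` columns opens one row of pre-weight 1, and each of
  -- the `m - j` rooks adds `s - 1`.
  e : ℕ → ℕ → X.Carrier
  e j m = X.fromℕ j X.* (X.1# X.- s) X.+ s X.* X.fromℕ m

  -- The effect of one more column on weights w that depend on the number
  -- k of rook-free columns: a + e k n is the total pre-weight of the new
  -- column, a being the share of the rows that were present initially.
  step : X.Carrier → ℕ → (ℕ → Carrier) → ℕ → Carrier
  step a n w k = E (a X.+ e k n) * w (suc k) + h * Q (a X.+ e k n) * w k

  -- The leftmost column is removed first and its effect absorbed into the weight. For `a = 0` this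
  -- is the weighted sum over placements, by `∑-placements`.
  total : X.Carrier → ℕ → (ℕ → Carrier) → Carrier
  total a zero    w = w 0
  total a (suc n) w = total a n (step a n w)

  -- Only arguments up to `n` matter, as at most `n` of `n` columns are free of rooks. This bound is
  -- what gives `total-δ` and the vanishing of `S n (+ k)` for `k > n`.
  total-cong : ∀ a n {v w} → (∀ k → k ℕ.≤ n → v k ≈ w k) → total a n v ≈ total a n w
  total-cong a zero    v≈w = v≈w 0 ℕ.z≤n
  total-cong a (suc n) v≈w = total-cong a n λ k k≤n →
    +-cong (*-congˡ (v≈w (suc k) (ℕ.s≤s k≤n))) (*-congˡ (v≈w k (ℕ.m≤n⇒m≤1+n k≤n)))

  total-congˡ : ∀ {a b} n w → a X.≈ b → total a n w ≈ total b n w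
  total-congˡ zero    w a≈b = refl
  total-congˡ {a} {b} (suc n) w a≈b = trans (total-congˡ n (step a n w) a≈b)
    (total-cong b n λ k _ →
      +-cong (*-congʳ (E-cong (X.+-congʳ a≈b)))
             (*-congʳ (*-congˡ (Q-cong (X.+-congʳ a≈b)))))

  total-+ : ∀ a n v w → total a n (λ k → v k + w k) ≈ total a n v + total a n w
  total-+ a zero    v w = refl
  total-+ a (suc n) v w = trans
    (total-cong a n λ k _ →
      solve 6 (λ x y v₁ w₁ v₀ w₀ →
        x :* (v₁ :+ w₁) :+ y :* (v₀ :+ w₀)
        := x :* v₁ :+ y :* v₀ :+ (x :* w₁ :+ y :* w₀)) refl
        (E (a X.+ e k n)) (h * Q (a X.+ e k n)) (v (suc k)) (w (suc k)) (v k) (w k))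
    (total-+ a n (step a n v) (step a n w))

  total-*ˡ : ∀ a n x w → total a n (λ k → x * w k) ≈ x * total a n w
  total-*ˡ a zero    x w = refl
  total-*ˡ a (suc n) x w = trans
    (total-cong a n λ k _ →
      solve 5 (λ x y z w₁ w₀ →
        y :* (x :* w₁) :+ z :* (x :* w₀) := x :* (y :* w₁ :+ z :* w₀)) refl
        x (E (a X.+ e k n)) (h * Q (a X.+ e k n)) (w (suc k)) (w k))
    (total-*ˡ a n x (step a n w))

  total-0 : ∀ a n → total a n (λ _ → 0#) ≈ 0#
  total-0 a n = trans (total-cong a n λ _ _ → sym (zeroˡ 0#))
                  (trans (total-*ˡ a n 0# (λ _ → 0#)) (zeroˡ _))

  total-∑ : ∀ a n (xs : List A) (f : A → ℕ → Carrier) →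
    total a n (λ k → ∑[ x ∈ xs ] f x k) ≈ (∑[ x ∈ xs ] total a n (f x))
  total-∑ a n []       f = total-0 a n
  total-∑ a n (x ∷ xs) f = trans (total-+ a n (f x) _) (+-congˡ (total-∑ a n xs f))

  -- By linearity, since up to `n` the weight `w` is the combination of the `δ j` with coefficients
  -- `w j`.
  total-δ : ∀ a n w → total a n w ≈ (∑[ j ∈ upTo (suc n) ] total a n (δ j) * w j)
  total-δ a n w = begin
    total a n w
      ≈⟨ total-cong a n (λ k k≤n → ∑-δ w (ℕ.s≤s k≤n)) ⟨
    total a n (λ k → ∑[ j ∈ upTo (suc n) ] w j * δ j k)
      ≈⟨ total-∑ a n (upTo (suc n)) (λ j k → w j * δ j k) ⟩
    (∑[ j ∈ upTo (suc n) ] total a n (λ k → w j * δ j k))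
      ≈⟨ ∑-cong (upTo (suc n)) (λ {j} _ → trans (total-*ˡ a n (w j) (δ j)) (*-comm _ _)) ⟩
    (∑[ j ∈ upTo (suc n) ] total a n (δ j) * w j) ∎

  fromℕ-+ : ∀ m n → X.fromℕ (m ℕ.+ n) X.≈ X.fromℕ m X.+ X.fromℕ n
  fromℕ-+ zero    n = X.sym (X.+-identityˡ _)
  fromℕ-+ (suc m) n = X.trans (X.+-congˡ (fromℕ-+ m n)) (X.sym (X.+-assoc _ _ _))

  e-+ : ∀ j k m n → e (j ℕ.+ k) (n ℕ.+ m) X.≈ e j m X.+ e k n
  e-+ j k m n = X.trans
    (X.+-cong (X.*-congʳ (fromℕ-+ j k)) (X.*-congˡ (fromℕ-+ n m)))
    (XS.solve 6 (λ j k m n t s →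
      (j XS.:+ k) XS.:* t XS.:+ s XS.:* (n XS.:+ m)
      XS.:= (j XS.:* t XS.:+ s XS.:* m) XS.:+ (k XS.:* t XS.:+ s XS.:* n)) X.refl
      (X.fromℕ j) (X.fromℕ k) (X.fromℕ m) (X.fromℕ n) (X.1# X.- s) s)

  -- The first m columns enter the later ones only through the total
  -- pre-weight e j m that they leave on their rows.
  total-append : ∀ n m w →
    total X.0# (n ℕ.+ m) w ≈ total X.0# m (λ j → total (e j m) n (λ k → w (j ℕ.+ k)))
  total-append zero    m w = total-cong X.0# m λ j _ →
    reflexive (≡.cong w (≡.sym (ℕ.+-identityʳ j)))
  total-append (suc n) m w = trans (total-append n m (step X.0# (n ℕ.+ m) w))
    (total-cong X.0# m λ j _ → total-cong (e j m) n λ k _ →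
      +-cong
        (*-cong (E-cong (shift j k)) (reflexive (≡.cong w (≡.sym (ℕ.+-suc j k)))))
        (*-congʳ (*-congˡ (Q-cong (shift j k)))))
    where
    shift : ∀ j k → X.0# X.+ e (j ℕ.+ k) (n ℕ.+ m) X.≈ e j m X.+ e k n
    shift j k = X.trans (X.+-identityˡ _) (e-+ j k m n)

  E-^ : ∀ x n → E (x X.* X.fromℕ n) ≈ E x ^ n
  E-^ x zero    = trans (E-cong (X.zeroʳ x)) E-0
  E-^ x (suc n) = begin
    E (x X.* (X.1# X.+ X.fromℕ n))
      ≈⟨ E-cong (X.trans (X.distribˡ _ _ _) (X.+-congʳ (X.*-identityʳ _))) ⟩
    E (x X.+ x X.* X.fromℕ n)
      ≈⟨ E-+ _ _ ⟩
    E x * E (x X.* X.fromℕ n)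
      ≈⟨ *-congˡ (E-^ x n) ⟩
    E x ^ suc n ∎

  -- The q-analogue of the rising factorial `a (a + s) (a + 2 s) ...` with `d` factors.
  rising : X.Carrier → ℕ → Carrier
  rising a d = ∏[ i ∈ upTo d ] Q (a X.+ s X.* X.fromℕ i)

  -- The coefficient of `total X.0# r w` in `total a n w` when `d = n - r`. Keeping `d` as an
  -- argument of its own permits recursion on it.
  coefficient : X.Carrier → ℕ → ℕ → ℕ → Carrier
  coefficient a n r d =
    h ^ d * E (X.fromℕ r X.* a) * gaussian (E s) n r * rising a d

  coefficient-> : ∀ a {n r} d → n ℕ.< r → coefficient a n r d ≈ 0#
  coefficient-> a d n<r = trans
    (*-congʳ (trans (*-congˡ (gaussian-> (E s) n<r)) (zeroʳ _))) (zeroˡ _)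

  coefficient-zero : ∀ a n →
    coefficient a (suc n) 0 (suc n) ≈
    coefficient a n 0 n * (h * Q (a X.+ s X.* X.fromℕ n))
  coefficient-zero a n = trans
    (*-congˡ (∏-upTo-sucʳ (λ i → Q (a X.+ s X.* X.fromℕ i)) n))
    (solve 6 (λ h x e g P q →
      (h :* x) :* e :* g :* (P :* q) := x :* e :* g :* P :* (h :* q)) refl
      h (h ^ n) (E (X.fromℕ 0 X.* a)) 1# (rising a n) (Q (a X.+ s X.* X.fromℕ n)))

  E-fromℕ-suc : ∀ a r → E (X.fromℕ (suc r) X.* a) ≈ E a * E (X.fromℕ r X.* a)
  E-fromℕ-suc a r = trans
    (E-cong (X.trans (X.distribʳ _ _ _) (X.+-congʳ (X.*-identityˡ _)))) (E-+ _ _)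

  -- The second Pascal rule splits the left side in two. In the first part the power `E s ^ d` and
  -- one factor `E a` combine to `E (a + s d)`; in the second, one `h` and the last factor of
  -- `rising` are taken off.
  coefficient-suc : ∀ a n r d → r ℕ.+ d ≡ n →
    coefficient a (suc n) (suc r) d ≈
    coefficient a n r d * E (a X.+ s X.* X.fromℕ d) +
    coefficient a n (suc r) (ℕ.pred d) * (h * Q (a X.+ s X.* X.fromℕ (ℕ.pred d)))
  coefficient-suc a n r d r+d≡n = begin
    h ^ d * E (X.fromℕ (suc r) X.* a) * gaussian (E s) (suc n) (suc r) * rising a d
      ≈⟨ *-congʳ (*-congˡ (gaussian-pascalʳ (E s) n r d r+d≡n)) ⟩
    h ^ d * E (X.fromℕ (suc r) X.* a) * (E s ^ d * g₀ + g₁) * rising a d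
      ≈⟨ solve 6 (λ x e y g₀ g₁ P →
           x :* e :* (y :* g₀ :+ g₁) :* P
           := x :* (e :* y) :* g₀ :* P :+ x :* e :* g₁ :* P) refl
           (h ^ d) (E (X.fromℕ (suc r) X.* a)) (E s ^ d) g₀ g₁ (rising a d) ⟩
    h ^ d * (E (X.fromℕ (suc r) X.* a) * E s ^ d) * g₀ * rising a d
      + h ^ d * E (X.fromℕ (suc r) X.* a) * g₁ * rising a d
      ≈⟨ +-cong left (right d r+d≡n) ⟩
    coefficient a n r d * E (a X.+ s X.* X.fromℕ d) +
    coefficient a n (suc r) (ℕ.pred d) * (h * Q (a X.+ s X.* X.fromℕ (ℕ.pred d))) ∎
    where
    g₀ g₁ : Carrier
    g₀ = gaussian (E s) n r
    g₁ = gaussian (E s) n (suc r)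

    left : h ^ d * (E (X.fromℕ (suc r) X.* a) * E s ^ d) * g₀ * rising a d ≈
           coefficient a n r d * E (a X.+ s X.* X.fromℕ d)
    left = begin
      h ^ d * (E (X.fromℕ (suc r) X.* a) * E s ^ d) * g₀ * rising a d
        ≈⟨ *-congʳ (*-congʳ (*-congˡ (*-cong (E-fromℕ-suc a r) (sym (E-^ s d))))) ⟩
      h ^ d * (E a * E (X.fromℕ r X.* a) * E (s X.* X.fromℕ d)) * g₀ * rising a d
        ≈⟨ solve 6 (λ x y z t g P →
             x :* (y :* z :* t) :* g :* P := x :* z :* g :* P :* (y :* t)) refl
             (h ^ d) (E a) (E (X.fromℕ r X.* a)) (E (s X.* X.fromℕ d)) g₀ (rising a d) ⟩
      coefficient a n r d * (E a * E (s X.* X.fromℕ d))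
        ≈⟨ *-congˡ (E-+ _ _) ⟨
      coefficient a n r d * E (a X.+ s X.* X.fromℕ d) ∎

    right : ∀ d → r ℕ.+ d ≡ n →
      h ^ d * E (X.fromℕ (suc r) X.* a) * g₁ * rising a d ≈
      coefficient a n (suc r) (ℕ.pred d) * (h * Q (a X.+ s X.* X.fromℕ (ℕ.pred d)))
    -- Here `pred` is truncated, but `r = n`, so both sides contain the vanishing Gaussian binomial
    -- of `n` over `n + 1`.
    right zero r+0≡n = trans (coefficient-> a 0 n<1+r)
      (sym (trans (*-congʳ (coefficient-> a 0 n<1+r)) (zeroˡ _)))
      where
      n<1+r : n ℕ.< suc r
      n<1+r = ℕ.s≤s (ℕ.≤-reflexive (≡.trans (≡.sym r+0≡n) (ℕ.+-identityʳ r)))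
    right (suc d) _ = trans
      (*-congˡ (∏-upTo-sucʳ (λ i → Q (a X.+ s X.* X.fromℕ i)) d))
      (solve 6 (λ h x e g P q →
        (h :* x) :* e :* g :* (P :* q) := x :* e :* g :* P :* (h :* q)) refl
        h (h ^ d) (E (X.fromℕ (suc r) X.* a)) g₁ (rising a d)
        (Q (a X.+ s X.* X.fromℕ d)))

  -- As `e k n = e k r + s d`, column `n + 1` has pre-weight `x + e k r` with `x = a + s d`. The
  -- addition laws for `E` and `Q` turn it into `E x` times an ordinary column `r + 1`, plus the
  -- term `h * Q x`, which does not depend on `k`.
  total-step : ∀ a n r d w → r ℕ.+ d ≡ n →
    total X.0# r (step a n w) ≈
    E (a X.+ s X.* X.fromℕ d) * total X.0# (suc r) w +
    h * Q (a X.+ s X.* X.fromℕ d) * total X.0# r w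
  total-step a n r d w ≡.refl = begin
    total X.0# r (step a n w)
      ≈⟨ total-cong X.0# r (λ k _ → pointwise k) ⟩
    total X.0# r (λ k → E x * step X.0# r w k + h * Q x * w k)
      ≈⟨ total-+ X.0# r _ _ ⟩
    total X.0# r (λ k → E x * step X.0# r w k) + total X.0# r (λ k → h * Q x * w k)
      ≈⟨ +-cong (total-*ˡ X.0# r _ _) (total-*ˡ X.0# r _ _) ⟩
    E x * total X.0# (suc r) w + h * Q x * total X.0# r w ∎
    where
    x : X.Carrier
    x = a X.+ s X.* X.fromℕ d

    split : ∀ k → a X.+ e k (r ℕ.+ d) X.≈ x X.+ (X.0# X.+ e k r)
    split k = X.trans
      (X.+-congˡ (X.+-congˡ (X.*-congˡ (fromℕ-+ r d))))
      (XS.solve 5 (λ a y s r d →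
        a XS.:+ (y XS.:+ s XS.:* (r XS.:+ d))
        XS.:= (a XS.:+ s XS.:* d) XS.:+ (XS.con 0 XS.:+ (y XS.:+ s XS.:* r))) X.refl
        a (X.fromℕ k X.* (X.1# X.- s)) s (X.fromℕ r) (X.fromℕ d))

    pointwise : ∀ k → step a n w k ≈ E x * step X.0# r w k + h * Q x * w k
    pointwise k = trans
      (+-cong (*-congʳ (trans (E-cong (split k)) (E-+ _ _)))
              (*-congʳ (*-congˡ (trans (Q-cong (split k)) (Q-+ _ _)))))
      (solve 7 (λ h e₁ e₂ q₁ q₂ w₁ w₀ →
        e₁ :* e₂ :* w₁ :+ h :* (q₁ :+ e₁ :* q₂) :* w₀
        := e₁ :* (e₂ :* w₁ :+ h :* q₂ :* w₀) :+ h :* q₁ :* w₀) refl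
        h (E x) (E (X.0# X.+ e k r)) (Q x) (Q (X.0# X.+ e k r)) (w (suc k)) (w k))

  -- Induction on `n` for all weights at once. By `total-step`, the term for `r` contributes to
  -- `r + 1` and to `r`, and collecting these contributions is the rule `coefficient-suc`.
  total-expand : ∀ a n w →
    total a n w ≈ (∑[ r ∈ upTo (suc n) ] coefficient a n r (n ∸ r) * total X.0# r w)
  total-expand a zero w = begin
    w 0
      ≈⟨ solve 1 (λ w → w := con 1 :* con 1 :* con 1 :* con 1 :* w :+ con 0) refl (w 0) ⟩
    1# * 1# * 1# * 1# * w 0 + 0#
      ≈⟨ +-congʳ (*-congʳ (*-congʳ (*-congʳ (*-congˡ
           (trans (E-cong (X.zeroˡ a)) E-0))))) ⟨
    1# * E (X.0# X.* a) * 1# * 1# * w 0 + 0# ∎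
  total-expand a (suc n) w = begin
    total a n (step a n w)
      ≈⟨ total-expand a n (step a n w) ⟩
    (∑[ r ∈ upTo (suc n) ] c₀ r * total X.0# r (step a n w))
      ≈⟨ ∑-cong (upTo (suc n)) (λ {r} r∈ → trans
           (*-congˡ (total-step a n r (n ∸ r) w (r+[n∸r] r∈)))
           (solve 5 (λ c x y z t →
             c :* (x :* y :+ z :* t) := c :* x :* y :+ c :* z :* t) refl
             (c₀ r) (E (x r)) (z (suc r)) (h * Q (x r)) (z r))) ⟩
    (∑[ r ∈ upTo (suc n) ] (c₀ r * E (x r) * z (suc r) + c₁ r * z r))
      ≈⟨ ∑-+ _ _ (upTo (suc n)) ⟩
    (∑[ r ∈ upTo (suc n) ] c₀ r * E (x r) * z (suc r))
      + (∑[ r ∈ upTo (suc n) ] c₁ r * z r)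
      -- Adding the zero term for `r = n + 1` lets the second sum be split at `r = 0` and shifted,
      -- so that both sums run over `z (suc r)`.
      ≈⟨ +-congˡ (trans (+-congˡ c₁≈0) (+-identityʳ _)) ⟨
    (∑[ r ∈ upTo (suc n) ] c₀ r * E (x r) * z (suc r))
      + ((∑[ r ∈ upTo (suc n) ] c₁ r * z r) + c₁ (suc n) * z (suc n))
      ≈⟨ +-congˡ (trans (sym (∑-upTo-sucʳ _ (suc n))) (∑-upTo-suc _ (suc n))) ⟩
    (∑[ r ∈ upTo (suc n) ] c₀ r * E (x r) * z (suc r))
      + (c₁ 0 * z 0 + (∑[ r ∈ upTo (suc n) ] c₁ (suc r) * z (suc r)))
      ≈⟨ solve 3 (λ x y z → x :+ (y :+ z) := y :+ (x :+ z)) refl _ _ _ ⟩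
    c₁ 0 * z 0 + ((∑[ r ∈ upTo (suc n) ] c₀ r * E (x r) * z (suc r))
      + (∑[ r ∈ upTo (suc n) ] c₁ (suc r) * z (suc r)))
      ≈⟨ +-cong (*-congʳ (coefficient-zero a n)) (∑-+ _ _ (upTo (suc n))) ⟨
    coefficient a (suc n) 0 (suc n) * z 0
      + (∑[ r ∈ upTo (suc n) ] (c₀ r * E (x r) * z (suc r) + c₁ (suc r) * z (suc r)))
      ≈⟨ +-congˡ (∑-cong (upTo (suc n)) (λ {r} r∈ → trans (sym (distribʳ _ _ _))
           (*-congʳ (sym (c-suc r∈))))) ⟩
    coefficient a (suc n) 0 (suc n) * z 0
      + (∑[ r ∈ upTo (suc n) ] coefficient a (suc n) (suc r) (n ∸ r) * z (suc r))
      ≈⟨ ∑-upTo-suc _ (suc n) ⟨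
    (∑[ r ∈ upTo (suc (suc n)) ] coefficient a (suc n) r (suc n ∸ r) * z r) ∎
    where
    x : ℕ → X.Carrier
    x r = a X.+ s X.* X.fromℕ (n ∸ r)

    z c₀ c₁ : ℕ → Carrier
    z r = total X.0# r w
    c₀ r = coefficient a n r (n ∸ r)
    c₁ r = c₀ r * (h * Q (x r))

    r+[n∸r] : ∀ {r} → r ∈ upTo (suc n) → r ℕ.+ (n ∸ r) ≡ n
    r+[n∸r] r∈ = ℕ.m+[n∸m]≡n (ℕ.s≤s⁻¹ (∈-upTo⁻ r∈))

    c₁≈0 : c₁ (suc n) * z (suc n) ≈ 0#
    c₁≈0 = trans (*-congʳ (trans
      (*-congʳ (coefficient-> a (n ∸ suc n) (ℕ.n<1+n n))) (zeroˡ _))) (zeroˡ _)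

    c-suc : ∀ {r} → r ∈ upTo (suc n) →
      coefficient a (suc n) (suc r) (n ∸ r) ≈ c₀ r * E (x r) + c₁ (suc r)
    -- `coefficient-suc` speaks of `pred (n ∸ r)`, while `c₁ (suc r)` contains `n ∸ suc r`.
    c-suc {r} r∈ = ≡.subst
      (λ d → coefficient a (suc n) (suc r) (n ∸ r) ≈ c₀ r * E (x r)
        + coefficient a n (suc r) d * (h * Q (a X.+ s X.* X.fromℕ d)))
      (ℕ.pred[m∸n]≡m∸[1+n] n r)
      (coefficient-suc a n r (n ∸ r) (r+[n∸r] r∈))

  -- After `total-append`, each inner sum is expanded with `a = e j m`; `total-δ` then makes the
  -- factor `total X.0# m (δ j)` explicit, which is `S m (+ j)` by `S-total`.
  total-convolution : ∀ n m w →
    total X.0# (n ℕ.+ m) w ≈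
    (∑[ r ∈ upTo (suc n) ] ∑[ j ∈ upTo (suc m) ]
      h ^ (n ∸ r) * E (X.fromℕ r X.* e j m) * gaussian (E s) n r
      * total X.0# m (δ j) * total X.0# r (λ k → w (j ℕ.+ k))
      * (∏[ i ∈ upTo (n ∸ r) ] Q (e j m X.+ s X.* X.fromℕ i)))
  total-convolution n m w = begin
    total X.0# (n ℕ.+ m) w
      ≈⟨ total-append n m w ⟩
    total X.0# m (λ j → total (e j m) n (λ k → w (j ℕ.+ k)))
      ≈⟨ total-cong X.0# m (λ j _ → total-expand (e j m) n _) ⟩
    total X.0# m (λ j → ∑[ r ∈ upTo (suc n) ] term r j)
      ≈⟨ total-∑ X.0# m (upTo (suc n)) term ⟩
    (∑[ r ∈ upTo (suc n) ] total X.0# m (term r))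
      ≈⟨ ∑-cong (upTo (suc n)) (λ {r} _ → trans (total-δ X.0# m (term r))
           (∑-cong (upTo (suc m)) (λ {j} _ →
             solve 6 (λ x y g P z t →
               t :* (x :* y :* g :* P :* z) := x :* y :* g :* t :* z :* P) refl
               (h ^ (n ∸ r)) (E (X.fromℕ r X.* e j m)) (gaussian (E s) n r)
               (rising (e j m) (n ∸ r)) (total X.0# r (λ k → w (j ℕ.+ k)))
               (total X.0# m (δ j))))) ⟩
    (∑[ r ∈ upTo (suc n) ] ∑[ j ∈ upTo (suc m) ]
      h ^ (n ∸ r) * E (X.fromℕ r X.* e j m) * gaussian (E s) n r
      * total X.0# m (δ j) * total X.0# r (λ k → w (j ℕ.+ k))
      * (∏[ i ∈ upTo (n ∸ r) ] Q (e j m X.+ s X.* X.fromℕ i))) ∎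
    where
    term : ℕ → ℕ → Carrier
    term r j = coefficient (e j m) n r (n ∸ r) * total X.0# r (λ k → w (j ℕ.+ k))

  e-1-1 : e 1 1 X.≈ X.1#
  e-1-1 = X.trans (X.+-cong (one* _) (X.trans (X.*-comm _ _) (one* _)))
    (X.trans (X.+-assoc _ _ _)
      (X.trans (X.+-congˡ (X.-‿inverseˡ s)) (X.+-identityʳ _)))
    where
    one* : ∀ x → X.fromℕ 1 X.* x X.≈ x
    one* x = X.trans (X.*-congʳ (X.+-identityʳ _)) (X.*-identityˡ x)

  -- The first column has no cells, so it carries no rook: its total pre-weight is 0, where `E` is 1
  -- and `Q` is 0.
  total-1 : ∀ w → total X.0# 1 w ≈ w 1
  total-1 w = begin
    E x * w 1 + h * Q x * w 0
      ≈⟨ +-cong (*-congʳ (trans (E-cong x≈0) E-0))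
           (*-congʳ (*-congˡ (trans (Q-cong x≈0) Q-0))) ⟩
    1# * w 1 + h * 0# * w 0
      ≈⟨ solve 3 (λ h w₁ w₀ → con 1 :* w₁ :+ h :* con 0 :* w₀ := w₁) refl h (w 1) (w 0) ⟩
    w 1 ∎
    where
    x : X.Carrier
    x = X.0# X.+ e 0 0

    x≈0 : x X.≈ X.0#
    x≈0 = X.trans (X.+-identityˡ _)
      (X.trans (X.+-cong (X.zeroˡ _) (X.zeroʳ _)) (X.+-identityˡ _))

  -- Splits off the first column instead of the last. Being empty, it is rook-free and leaves a
  -- single row of pre-weight `e 1 1 = 1` to the other `n` columns.
  total-recurrence : ∀ n w →
    total X.0# (suc n) w ≈
    (∑[ r ∈ upTo (suc n) ]
      h ^ (n ∸ r) * E (X.fromℕ r) * gaussian (E s) n r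
      * total X.0# r (w ∘ suc)
      * (∏[ i ∈ upTo (n ∸ r) ] Q (X.1# X.+ s X.* X.fromℕ i)))
  total-recurrence n w = begin
    total X.0# (suc n) w
      ≡⟨ ≡.cong (λ m → total X.0# m w) (ℕ.+-comm 1 n) ⟩
    total X.0# (n ℕ.+ 1) w
      ≈⟨ total-append n 1 w ⟩
    total X.0# 1 (λ j → total (e j 1) n (λ k → w (j ℕ.+ k)))
      ≈⟨ total-1 (λ j → total (e j 1) n (λ k → w (j ℕ.+ k))) ⟩
    total (e 1 1) n (w ∘ suc)
      ≈⟨ total-congˡ n (w ∘ suc) e-1-1 ⟩
    total X.1# n (w ∘ suc)
      ≈⟨ total-expand X.1# n (w ∘ suc) ⟩
    (∑[ r ∈ upTo (suc n) ] coefficient X.1# n r (n ∸ r) * total X.0# r (w ∘ suc))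
      ≈⟨ ∑-cong (upTo (suc n)) (λ {r} _ → trans
           (*-congʳ (*-congʳ (*-congʳ (*-congˡ (E-cong (X.*-identityʳ (X.fromℕ r)))))))
           (solve 5 (λ x y g P z → x :* y :* g :* P :* z := x :* y :* g :* z :* P) refl
             (h ^ (n ∸ r)) (E (X.fromℕ r)) (gaussian (E s) n r)
             (rising X.1# (n ∸ r)) (total X.0# r (w ∘ suc)))) ⟩
    (∑[ r ∈ upTo (suc n) ]
      h ^ (n ∸ r) * E (X.fromℕ r) * gaussian (E s) n r
      * total X.0# r (w ∘ suc)
      * (∏[ i ∈ upTo (n ∸ r) ] Q (X.1# X.+ s X.* X.fromℕ i))) ∎

  e-suc : ∀ j m → e j (suc m) X.≈ e j m X.+ s
  e-suc j m = XS.solve 4 (λ j t s m →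
      j XS.:* t XS.:+ s XS.:* (XS.con 1 XS.:+ m)
      XS.:= j XS.:* t XS.:+ s XS.:* m XS.:+ s) X.refl
    (X.fromℕ j) (X.1# X.- s) s (X.fromℕ m)

  e-suc-suc : ∀ j m → e (suc j) (suc m) X.≈ e j m X.+ X.1#
  e-suc-suc j m = X.trans
    (X.reflexive (≡.cong (λ i → e i (suc m)) (ℕ.+-comm 1 j)))
    (X.trans (e-+ j 1 m 1) (X.+-congˡ e-1-1))

-- Counting rook-free columns.

free : ∀ {n} → Placement n → ℕ
free []            = 0
free (ψ ▹ nothing) = suc (free ψ)
free (ψ ▹ just _)  = free ψ

free+rooks : ∀ {n} (ψ : Placement n) → free ψ ℕ.+ rooks ψ ≡ n
free+rooks []            = ≡.refl
free+rooks (ψ ▹ nothing) = ≡.cong suc (free+rooks ψ)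
free+rooks (ψ ▹ just _)  =
  ≡.trans (ℕ.+-suc (free ψ) (rooks ψ)) (≡.cong suc (free+rooks ψ))

-- The real power at exponent zero.

module RealPowerProperties
  (ℝ : RealNumbers c ℓ) (power : RealPower ℝ)
  (q : RealNumbers.Carrier ℝ)
  (0<q : RealNumbers._<_ ℝ (RealNumbers.0# ℝ) q)
  where

  open RealNumbers ℝ
  open RealPower power
  open SetoidReasoning setoid

  q≉0 : ¬ (q ≈ 0#)
  q≉0 q≈0 = irrefl (sym q≈0) 0<q
    where open IsStrictTotalOrder isStrictTotalOrder using (irrefl)

  -- Cancel the nonzero factor `q = q ^ 1#` in `q ^ (1# + 0#) ≈ q ^ 1# * q ^ 0#`.
  ^-0 : q ^ 0# ≈ 1#
  ^-0 = begin
    q ^ 0#                   ≈⟨ *-identityˡ _ ⟨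
    1# * q ^ 0#              ≈⟨ *-congʳ (⁻¹-inverseʳ q q≉0) ⟨
    q * q ⁻¹ * q ^ 0#        ≈⟨ trans (*-assoc _ _ _) (*-congˡ (*-comm _ _)) ⟩
    q * (q ^ 0# * q ⁻¹)      ≈⟨ *-assoc _ _ _ ⟨
    q * q ^ 0# * q ⁻¹        ≈⟨ *-congʳ (*-congʳ (^-1 0<q)) ⟨
    q ^ 1# * q ^ 0# * q ⁻¹   ≈⟨ *-congʳ (^-+-homo 0<q 1# 0#) ⟨
    q ^ (1# + 0#) * q ⁻¹     ≈⟨ *-congʳ (^-cong 0<q refl (+-identityʳ 1#)) ⟩
    q ^ 1# * q ⁻¹            ≈⟨ *-congʳ (^-1 0<q) ⟩
    q * q ⁻¹                 ≈⟨ ⁻¹-inverseʳ q q≉0 ⟩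
    1#                       ∎

-- Rook numbers as column sums.

module RookNumberProperties
  (ℝ : RealNumbers c ℓ) (power : RealPower ℝ)
  (s : RealNumbers.Carrier ℝ) (h : Complex.ℂ ℝ) (q : RealNumbers.Carrier ℝ)
  (0<q : RealNumbers._<_ ℝ (RealNumbers.0# ℝ) q)
  where

  open RealNumbers ℝ hiding (zero)
  open RealPower power
  open RealPowerProperties ℝ power q 0<q
  open Complex ℝ
  open RookNumbers ℝ power s h q
  open RingProperties ring using (-0#≈0#)
  private
    module ℂ = CommutativeRing complexRing
    module ∑ℂ = BigOperatorProperties complexRing
    module ∑ℝ = BigOperatorProperties commutativeRing
    module ℝ∑ = BigOperators commutativeRing
  open BigOperators complexRing

  []q-cong : ∀ {x y} → x ≈ y → [ x ]q ≈ [ y ]q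
  []q-cong x≈y with q ≟ 1#
  ... | yes _ = x≈y
  ... | no  _ = *-congʳ (+-congʳ (^-cong 0<q refl x≈y))

  []q-0 : [ 0# ]q ≈ 0#
  []q-0 with q ≟ 1#
  ... | yes _ = refl
  ... | no  _ = trans (*-congʳ (trans (+-congʳ ^-0) (-‿inverseʳ 1#))) (zeroˡ _)

  -- For `q` other than 1 this is `q ^ (x + y) - 1 = (q ^ x - 1) + q ^ x (q ^ y - 1)` divided by `q
  -- - 1`; for `q = 1` the power is 1 and the law is plain addition.
  []q-+ : ∀ x y → [ x + y ]q ≈ [ x ]q + q ^ x * [ y ]q
  []q-+ x y with q ≟ 1#
  ... | yes q≈1 = +-congˡ (sym (trans
    (*-congʳ (trans (^-cong 0<q q≈1 refl) (1^ x))) (*-identityˡ y)))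
  ... | no  _ = begin
    (q ^ (x + y) - 1#) * i
      ≈⟨ *-congʳ (+-congʳ (^-+-homo 0<q x y)) ⟩
    (a * b - 1#) * i
      -- The semiring solver treats `- 1#` as a variable, so the cancelling pair `a + a * - 1#` is
      -- inserted beforehand.
      ≈⟨ *-congʳ (+-congʳ (+-identityˡ _)) ⟨
    (0# + a * b - 1#) * i
      ≈⟨ *-congʳ (+-congʳ (+-congʳ a-a)) ⟨
    (a + a * - 1# + a * b - 1#) * i
      ≈⟨ solve 4 (λ a b i ε → (a :+ a :* ε :+ a :* b :+ ε) :* i
           := (a :+ ε) :* i :+ a :* ((b :+ ε) :* i)) refl a b i (- 1#) ⟩
    (a - 1#) * i + a * ((b - 1#) * i) ∎
    where
    open SetoidReasoning setoid
    open SemiringSolver commutativeSemiring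
      using (solve; _:=_; _:+_; _:*_)
    a b i : Carrier
    a = q ^ x
    b = q ^ y
    i = (q - 1#) ⁻¹

    a-a : a + a * - 1# ≈ 0#
    a-a = trans (+-congʳ (sym (*-identityʳ a)))
      (trans (sym (distribˡ a 1# (- 1#))) (trans (*-congˡ (-‿inverseʳ 1#)) (zeroʳ a)))

  ι-+ : ∀ x y → ι (x + y) ≈ᶜ ι x ℂ.+ ι y
  ι-+ x y = refl , sym (+-identityˡ 0#)

  ι-* : ∀ x y → ι (x * y) ≈ᶜ ι x *ᶜ ι y
  ι-* x y =
    sym (trans (+-congˡ (trans (-‿cong (zeroˡ 0#)) -0#≈0#)) (+-identityʳ _)) ,
    sym (trans (+-cong (zeroʳ x) (zeroˡ y)) (+-identityˡ 0#))

  ι-^ : ∀ x n → ι (SemiringExp._^_ semiring x n) ≈ᶜ ι x ^ᶜ n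
  ι-^ x zero    = ℂ.refl
  ι-^ x (suc n) = ℂ.trans (ι-* x _) (ℂ.*-congˡ {ι x} (ι-^ x n))

  -- The theorem evaluates the polynomial at the real number `q ^ s` and then embeds the value,
  -- whereas the column sums use its value at `E s` in the complex ring.
  ι-gaussian : ∀ p n k → ι (Gaussian.gaussian commutativeRing p n k) ≈ᶜ
                         Gaussian.gaussian complexRing (ι p) n k
  ι-gaussian p n       zero    = ℂ.refl
  ι-gaussian p zero    (suc k) = ℂ.refl
  ι-gaussian p (suc n) (suc k) = ℂ.trans (ι-+ _ _) (ℂ.+-cong (ι-gaussian p n k)
    (ℂ.trans (ι-* _ _)
      (ℂ.*-cong {ι (SemiringExp._^_ semiring p (suc k))}
        (ι-^ p (suc k)) (ι-gaussian p n (suc k)))))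

  q-exponential : QExponential ℝ complexRing
  q-exponential = record
    { E      = λ x → ι (q ^ x)
    ; Q      = λ x → ι [ x ]q
    ; E-cong = λ x≈y → ^-cong 0<q refl x≈y , refl
    ; Q-cong = λ x≈y → []q-cong x≈y , refl
    ; E-0    = ^-0 , refl
    ; E-+    = λ x y → ℂ.trans (^-+-homo 0<q x y , refl) (ι-* _ _)
    ; Q-0    = []q-0 , refl
    ; Q-+    = λ x y → ℂ.trans ([]q-+ x y , refl)
        (ℂ.trans (ι-+ _ _) (ℂ.+-congˡ {ι [ x ]q} (ι-* _ _)))
    }

  open QExponential q-exponential public
  open Columns ℝ complexRing q-exponential s h public

  -- The rooks of a placement on `n` columns stand in rows numbered below `n`, so later rows keep
  -- the default pre-weight.
  preWeight-≥ : ∀ {n} (ψ : Placement n) {r} → n ℕ.≤ r → preWeight ψ r ≡ 1#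
  preWeight-≥ []            _   = ≡.refl
  preWeight-≥ (ψ ▹ nothing) n<r = preWeight-≥ ψ (ℕ.<⇒≤ n<r)
  preWeight-≥ (ψ ▹ just ρ) {r} n<r = ≡.trans
    (≡.cong (λ b → if b then preWeight ψ r + (s - 1#) else preWeight ψ r)
      (dec-false (toℕ ρ ℕ.≟ r) (ℕ.<⇒≢ (ℕ.<-trans (Fin.toℕ<n ρ) n<r))))
    (preWeight-≥ ψ (ℕ.<⇒≤ n<r))

  ∑-preWeight-suc : ∀ {n} (ψ : Placement n) →
    ℝ∑.∑ (upTo (suc n)) (preWeight ψ) ≈ ℝ∑.∑ (upTo n) (preWeight ψ) + 1#
  ∑-preWeight-suc {n} ψ = trans (∑ℝ.∑-upTo-sucʳ (preWeight ψ) n)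
    (+-congˡ (reflexive (preWeight-≥ ψ ℕ.≤-refl)))

  -- Each new column opens a row of pre-weight 1, and its rook, if any, adds `s - 1` to one row. The
  -- sum thus grows by 1 or by `s`, as `e` does in `e-suc-suc` and `e-suc`, whichever row the rook
  -- occupies.
  ∑-preWeight : ∀ {n} (ψ : Placement n) →
    ℝ∑.∑ (upTo n) (preWeight ψ) ≈ e (free ψ) n
  ∑-preWeight [] =
    sym (trans (+-cong (zeroˡ _) (zeroʳ _)) (+-identityˡ _))
  ∑-preWeight {suc n} (ψ ▹ nothing) = trans (∑-preWeight-suc ψ)
    (trans (+-congʳ (∑-preWeight ψ)) (sym (e-suc-suc (free ψ) n)))
  ∑-preWeight {suc n} (ψ ▹ just ρ) = begin
    ℝ∑.∑ (upTo (suc n)) (preWeight (ψ ▹ just ρ))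
      ≈⟨ ∑ℝ.∑-cong (upTo (suc n)) (λ {r} _ → added r) ⟩
    ℝ∑.∑ (upTo (suc n)) (λ r → preWeight ψ r + (s - 1#) * ∑ℝ.δ r (toℕ ρ))
      ≈⟨ ∑ℝ.∑-+ _ _ (upTo (suc n)) ⟩
    ℝ∑.∑ (upTo (suc n)) (preWeight ψ)
      + ℝ∑.∑ (upTo (suc n)) (λ r → (s - 1#) * ∑ℝ.δ r (toℕ ρ))
      ≈⟨ +-cong (∑-preWeight-suc ψ)
           (∑ℝ.∑-δ (λ _ → s - 1#) (ℕ.m<n⇒m<1+n (Fin.toℕ<n ρ))) ⟩
    ℝ∑.∑ (upTo n) (preWeight ψ) + 1# + (s - 1#)
      ≈⟨ +-assoc _ _ _ ⟩
    ℝ∑.∑ (upTo n) (preWeight ψ) + (1# + (s - 1#))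
      ≈⟨ +-cong (∑-preWeight ψ) (trans (+-comm _ _) (trans (+-assoc _ _ _)
           (trans (+-congˡ (-‿inverseˡ 1#)) (+-identityʳ s)))) ⟩
    e (free ψ) n + s
      ≈⟨ e-suc (free ψ) n ⟨
    e (free ψ) (suc n) ∎
    where
    open SetoidReasoning setoid
    if-+ : ∀ b x y → (if b then x + y else x) ≈ x + y * (if b then 1# else 0#)
    if-+ true  x y = +-congˡ (sym (*-identityʳ y))
    if-+ false x y = sym (trans (+-congˡ (zeroʳ y)) (+-identityʳ x))

    added : ∀ r → preWeight (ψ ▹ just ρ) r ≈
                  preWeight ψ r + (s - 1#) * ∑ℝ.δ r (toℕ ρ)
    added r = trans (if-+ (does (toℕ ρ ℕ.≟ r)) _ _)
      (+-congˡ (*-congˡ (reflexive (∑ℝ.δ-sym (toℕ ρ) r))))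

  -- The weight of a single column.

  cellWeight-< : ∀ {n} {ρ r : Fin n} → toℕ r ℕ.< toℕ ρ → ∀ p →
                 cellWeight (just ρ) r p ≡ 1ᶜ
  cellWeight-< {ρ = ρ} {r} r<ρ p with ℕ.<-cmp (toℕ r) (toℕ ρ)
  ... | tri< _ _ _   = ≡.refl
  ... | tri≈ r≮ρ _ _ = contradiction r<ρ r≮ρ
  ... | tri> r≮ρ _ _ = contradiction r<ρ r≮ρ

  cellWeight-> : ∀ {n} {ρ r : Fin n} → toℕ ρ ℕ.< toℕ r → ∀ p →
                 cellWeight (just ρ) r p ≡ E p
  cellWeight-> {ρ = ρ} {r} r>ρ p with ℕ.<-cmp (toℕ r) (toℕ ρ)
  ... | tri< _ _ r≯ρ = contradiction r>ρ r≯ρ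
  ... | tri≈ _ _ r≯ρ = contradiction r>ρ r≯ρ
  ... | tri> _ _ _   = ≡.refl

  cellWeight-≡ : ∀ {n} (ρ : Fin n) p → cellWeight (just ρ) ρ p ≡ h *ᶜ Q p
  cellWeight-≡ ρ p with ℕ.<-cmp (toℕ ρ) (toℕ ρ)
  ... | tri< _ ρ≢ρ _ = contradiction ≡.refl ρ≢ρ
  ... | tri≈ _ _ _   = ≡.refl
  ... | tri> _ ρ≢ρ _ = contradiction ≡.refl ρ≢ρ

  -- Only the position relative to the rook matters, so the top row may be deleted in an induction
  -- on rows.
  cellWeight-suc : ∀ {n} (ρ r : Fin n) p →
    cellWeight (just (suc ρ)) (suc r) p ≡ cellWeight (just ρ) r p
  cellWeight-suc ρ r p with ℕ.<-cmp (toℕ r) (toℕ ρ)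
  ... | tri< r<ρ _ _ = cellWeight-< (ℕ.s≤s r<ρ) p
  ... | tri> _ _ r>ρ = cellWeight-> (ℕ.s≤s r>ρ) p
  ... | tri≈ _ r≡ρ _ = ≡.trans
    (≡.cong (λ r → cellWeight (just (suc ρ)) (suc r) p) (Fin.toℕ-injective r≡ρ))
    (cellWeight-≡ (suc ρ) p)

  columnWeight : ∀ {n} → (Fin n → Carrier) → Maybe (Fin n) → ℂ
  columnWeight {n} p x = ∏[ r ∈ allFin n ] cellWeight x r (p r)

  ∏-E : ∀ {n} (p : Fin n → Carrier) →
        (∏[ r ∈ allFin n ] E (p r)) ≈ᶜ E (ℝ∑.∑ (allFin n) p)
  ∏-E {zero}  p = ℂ.sym E-0
  ∏-E {suc n} p = begin
    (∏[ r ∈ allFin (suc n) ] E (p r))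
      ≈⟨ ∑ℂ.∏-allFin-suc n (λ r → E (p r)) ⟩
    E (p zero) *ᶜ (∏[ r ∈ allFin n ] E (p (suc r)))
      ≈⟨ ℂ.*-congˡ {E (p zero)} (∏-E (p ∘ suc)) ⟩
    E (p zero) *ᶜ E (ℝ∑.∑ (allFin n) (p ∘ suc))
      ≈⟨ E-+ _ _ ⟨
    E (p zero + ℝ∑.∑ (allFin n) (p ∘ suc))
      ≈⟨ E-cong (∑ℝ.∑-allFin-suc n p) ⟨
    E (ℝ∑.∑ (allFin (suc n)) p) ∎
    where open SetoidReasoning ℂ.setoid

  columnWeight-zero : ∀ {n} (p : Fin (suc n) → Carrier) →
    columnWeight p (just zero) ≈ᶜ
    h *ᶜ Q (p zero) *ᶜ E (ℝ∑.∑ (allFin n) (p ∘ suc))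
  columnWeight-zero {n} p = begin
    columnWeight p (just zero)
      ≈⟨ ∑ℂ.∏-allFin-suc n (λ r → cellWeight (just zero) r (p r)) ⟩
    cellWeight {suc n} (just zero) zero (p zero)
      *ᶜ (∏[ r ∈ allFin n ] cellWeight (just zero) (suc r) (p (suc r)))
      ≈⟨ ℂ.*-cong (ℂ.reflexive (cellWeight-≡ {suc n} zero (p zero)))
           (∑ℂ.∏-cong (allFin n) (λ r →
             ℂ.reflexive (cellWeight-> {ρ = zero} {suc r} ℕ.z<s (p (suc r))))) ⟩
    h *ᶜ Q (p zero) *ᶜ (∏[ r ∈ allFin n ] E (p (suc r)))
      ≈⟨ ℂ.*-congˡ {h *ᶜ Q (p zero)} (∏-E (p ∘ suc)) ⟩
    h *ᶜ Q (p zero) *ᶜ E (ℝ∑.∑ (allFin n) (p ∘ suc)) ∎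
    where open SetoidReasoning ℂ.setoid

  columnWeight-suc : ∀ {n} (p : Fin (suc n) → Carrier) ρ →
    columnWeight p (just (suc ρ)) ≈ᶜ columnWeight (p ∘ suc) (just ρ)
  columnWeight-suc {n} p ρ = begin
    columnWeight p (just (suc ρ))
      ≈⟨ ∑ℂ.∏-allFin-suc n (λ r → cellWeight (just (suc ρ)) r (p r)) ⟩
    cellWeight (just (suc ρ)) zero (p zero)
      *ᶜ (∏[ r ∈ allFin n ] cellWeight (just (suc ρ)) (suc r) (p (suc r)))
      ≈⟨ ℂ.*-cong (ℂ.reflexive (cellWeight-< {ρ = suc ρ} {zero} ℕ.z<s (p zero)))
           (∑ℂ.∏-cong (allFin n) (λ r → ℂ.reflexive (cellWeight-suc ρ r (p (suc r))))) ⟩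
    1ᶜ *ᶜ columnWeight (p ∘ suc) (just ρ)
      ≈⟨ ℂ.*-identityˡ _ ⟩
    columnWeight (p ∘ suc) (just ρ) ∎
    where open SetoidReasoning ℂ.setoid

  -- The cells above the rook have weight 1 and those below it contribute
  -- a power of q, so the sum telescopes by Q-+.
  ∑-columnWeight : ∀ {n} (p : Fin n → Carrier) →
    (∑[ ρ ∈ allFin n ] columnWeight p (just ρ)) ≈ᶜ h *ᶜ Q (ℝ∑.∑ (allFin n) p)
  ∑-columnWeight {zero}  p = ℂ.sym (ℂ.trans (ℂ.*-congˡ {h} Q-0) (ℂ.zeroʳ h))
  ∑-columnWeight {suc n} p = begin
    (∑[ ρ ∈ allFin (suc n) ] columnWeight p (just ρ))
      ≈⟨ ∑ℂ.∑-allFin-suc n (λ ρ → columnWeight p (just ρ)) ⟩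
    columnWeight p (just zero) ℂ.+ (∑[ ρ ∈ allFin n ] columnWeight p (just (suc ρ)))
      ≈⟨ ℂ.+-cong (columnWeight-zero p)
           (ℂ.trans (∑ℂ.∑-cong (allFin n) (λ {ρ} _ → columnWeight-suc p ρ))
             (∑-columnWeight (p ∘ suc))) ⟩
    h *ᶜ Q (p zero) *ᶜ E Σp ℂ.+ h *ᶜ Q Σp
      -- A rook in the top cell is accompanied by the powers of `q` of all cells below it, so `Q-+`
      -- is applied with the lower rows as first summand.
      ≈⟨ solve 4 (λ h x y z → h :* x :* y :+ h :* z := h :* (z :+ y :* x)) ℂ.refl
           h (Q (p zero)) (E Σp) (Q Σp) ⟩
    h *ᶜ (Q Σp ℂ.+ E Σp *ᶜ Q (p zero))
      ≈⟨ ℂ.*-congˡ {h} (Q-+ Σp (p zero)) ⟨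
    h *ᶜ Q (Σp + p zero)
      ≈⟨ ℂ.*-congˡ {h} (Q-cong (trans (∑ℝ.∑-allFin-suc n p) (+-comm _ _))) ⟨
    h *ᶜ Q (ℝ∑.∑ (allFin (suc n)) p) ∎
    where
    open SetoidReasoning ℂ.setoid
    open SemiringSolver ℂ.commutativeSemiring
      using (solve; _:=_; _:+_; _:*_)
    Σp : Carrier
    Σp = ℝ∑.∑ (allFin n) (p ∘ suc)

  -- The two terms of `step` are the two kinds of extension: a rook-free column, which raises
  -- `free`, and a column with a rook, summed over its rows. Both depend on `ψ` only through `ω ψ`
  -- and `free ψ`, by `∑-preWeight`.
  ∑-extensions : ∀ {n} (ψ : Placement n) w →
    ∑ (map (ψ ▹_) (nothing ∷ map just (allFin n))) (λ φ → ω φ *ᶜ w (free φ)) ≈ᶜ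
    ω ψ *ᶜ step 0# n w (free ψ)
  ∑-extensions {n} ψ w = begin
    ω ψ *ᶜ columnWeight p nothing *ᶜ w (suc (free ψ))
      ℂ.+ ∑ (map (ψ ▹_) (map just (allFin n))) (λ φ → ω φ *ᶜ w (free φ))
      ≈⟨ ℂ.+-congˡ {ω ψ *ᶜ columnWeight p nothing *ᶜ w (suc (free ψ))}
           (ℂ.trans (∑ℂ.∑-map _ (ψ ▹_) (map just (allFin n)))
             (∑ℂ.∑-map _ just (allFin n))) ⟩
    ω ψ *ᶜ columnWeight p nothing *ᶜ w (suc (free ψ))
      ℂ.+ (∑[ ρ ∈ allFin n ] ω ψ *ᶜ columnWeight p (just ρ) *ᶜ w (free ψ))
      ≈⟨ ℂ.+-congˡ {ω ψ *ᶜ columnWeight p nothing *ᶜ w (suc (free ψ))}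
           (ℂ.trans
             (∑ℂ.∑-cong (allFin n) (λ {ρ} _ →
               swap (ω ψ) (columnWeight p (just ρ)) (w (free ψ))))
             (∑ℂ.∑-*ˡ (ω ψ *ᶜ w (free ψ)) (λ ρ → columnWeight p (just ρ)) (allFin n))) ⟩
    ω ψ *ᶜ columnWeight p nothing *ᶜ w (suc (free ψ))
      ℂ.+ ω ψ *ᶜ w (free ψ) *ᶜ (∑[ ρ ∈ allFin n ] columnWeight p (just ρ))
      ≈⟨ ℂ.+-cong
           (ℂ.*-congʳ {w (suc (free ψ))} (ℂ.*-congˡ {ω ψ} (ℂ.trans (∏-E p) (E-cong Σp≈))))
           (ℂ.*-congˡ {ω ψ *ᶜ w (free ψ)}
             (ℂ.trans (∑-columnWeight p) (ℂ.*-congˡ {h} (Q-cong Σp≈)))) ⟩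
    ω ψ *ᶜ E x *ᶜ w (suc (free ψ)) ℂ.+ ω ψ *ᶜ w (free ψ) *ᶜ (h *ᶜ Q x)
      ≈⟨ solve 6 (λ o e q h w₁ w₀ →
           o :* e :* w₁ :+ o :* w₀ :* (h :* q) := o :* (e :* w₁ :+ h :* q :* w₀)) ℂ.refl
           (ω ψ) (E x) (Q x) h (w (suc (free ψ))) (w (free ψ)) ⟩
    ω ψ *ᶜ step 0# n w (free ψ) ∎
    where
    open SetoidReasoning ℂ.setoid
    open SemiringSolver ℂ.commutativeSemiring
      using (solve; _:=_; _:+_; _:*_)

    p : Fin n → Carrier
    p r = preWeight ψ (toℕ r)

    x : Carrier
    x = 0# + e (free ψ) n

    Σp≈ : ℝ∑.∑ (allFin n) p ≈ x
    Σp≈ = trans (∑ℝ.∑-allFin-toℕ n (preWeight ψ))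
      (trans (∑-preWeight ψ) (sym (+-identityˡ _)))

    swap : ∀ x y z → x *ᶜ y *ᶜ z ≈ᶜ x *ᶜ z *ᶜ y
    swap = solve 3 (λ x y z → x :* y :* z := x :* z :* y) ℂ.refl

  -- Summing out the last column replaces `w` by `step 0# n w`, so the induction must range over all
  -- weights.
  ∑-placements : ∀ n w →
    (∑[ ψ ∈ placements n ] ω ψ *ᶜ w (free ψ)) ≈ᶜ total 0# n w
  ∑-placements zero    w = ℂ.trans (ℂ.+-identityʳ _) (ℂ.*-identityˡ _)
  ∑-placements (suc n) w = begin
    (∑[ φ ∈ placements (suc n) ] ω φ *ᶜ w (free φ))
      ≈⟨ ∑ℂ.∑-concatMap (λ φ → ω φ *ᶜ w (free φ))
           (λ ψ → map (ψ ▹_) (nothing ∷ map just (allFin n))) (placements n) ⟩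
    (∑[ ψ ∈ placements n ]
      ∑ (map (ψ ▹_) (nothing ∷ map just (allFin n))) (λ φ → ω φ *ᶜ w (free φ)))
      ≈⟨ ∑ℂ.∑-cong (placements n) (λ {ψ} _ → ∑-extensions ψ w) ⟩
    (∑[ ψ ∈ placements n ] ω ψ *ᶜ step 0# n w (free ψ))
      ≈⟨ ∑-placements n (step 0# n w) ⟩
    total 0# n (step 0# n w) ∎
    where open SetoidReasoning ℂ.setoid

  -- The numbers of rooks and of rook-free columns add up to `n`; `k ≤ n` allows the truncated
  -- subtractions from `n` to be cancelled.
  δ-free : ∀ {n k} → k ℕ.≤ n → (ψ : Placement n) →
           ∑ℂ.δ (rooks ψ) (n ∸ k) ≈ᶜ ∑ℂ.δ k (free ψ)
  δ-free {n} {k} k≤n ψ = ∑ℂ.δ-⇔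
    (λ rooks≡ → ℕ.∸-cancelˡ-≡ k≤n free≤n (≡.trans (≡.sym rooks≡) rooks≡n∸free))
    (λ k≡free → ≡.trans rooks≡n∸free (≡.cong (n ∸_) (≡.sym k≡free)))
    where
    free≤n : free ψ ℕ.≤ n
    free≤n = ℕ.m+n≤o⇒m≤o (free ψ) (ℕ.≤-reflexive (free+rooks ψ))

    rooks≡n∸free : rooks ψ ≡ n ∸ free ψ
    rooks≡n∸free = ≡.trans (≡.sym (ℕ.m+n∸m≡n (free ψ) (rooks ψ)))
      (≡.cong (_∸ free ψ) (free+rooks ψ))

  -- Having `n - k` rooks means having `k` rook-free columns. For `k > n` the left side is 0 by
  -- definition, and `δ k` vanishes on all possible numbers of rook-free columns.
  S-total : ∀ n k → S n (+ k) ≈ᶜ total 0# n (∑ℂ.δ k)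
  S-total n k with k ℕ.≤? n
  ... | yes k≤n = begin
    S n (+ k)
      ≡⟨ ≡.cong (λ b → if b then (∑[ ψ ∈ C* n (n ∸ k) ] ω ψ) else 0ᶜ)
           (dec-true (k ℕ.≤? n) k≤n) ⟩
    (∑[ ψ ∈ C* n (n ∸ k) ] ω ψ)
      ≈⟨ ∑ℂ.∑-filter (λ ψ → rooks ψ ℕ.≟ n ∸ k) ω (placements n) ⟩
    (∑[ ψ ∈ placements n ] ω ψ *ᶜ ∑ℂ.δ (rooks ψ) (n ∸ k))
      ≈⟨ ∑ℂ.∑-cong (placements n) (λ {ψ} _ → ℂ.*-congˡ {ω ψ} (δ-free k≤n ψ)) ⟩
    (∑[ ψ ∈ placements n ] ω ψ *ᶜ ∑ℂ.δ k (free ψ))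
      ≈⟨ ∑-placements n (∑ℂ.δ k) ⟩
    total 0# n (∑ℂ.δ k) ∎
    where open SetoidReasoning ℂ.setoid
  ... | no k≰n = begin
    S n (+ k)
      ≡⟨ ≡.cong (λ b → if b then (∑[ ψ ∈ C* n (n ∸ k) ] ω ψ) else 0ᶜ)
           (dec-false (k ℕ.≤? n) k≰n) ⟩
    0ᶜ
      ≈⟨ total-0 0# n ⟨
    total 0# n (λ _ → 0ᶜ)
      ≈⟨ total-cong 0# n (λ j j≤n → ∑ℂ.δ-≢ (ℕ.<⇒≢ (ℕ.≤-<-trans j≤n (ℕ.≰⇒> k≰n)) ∘ ≡.sym)) ⟨
    total 0# n (∑ℂ.δ k) ∎
    where open SetoidReasoning ℂ.setoid

  -- If `j ≤ k`, cancel `j` inside `δ`. Otherwise the index on the left is negative, and `j + i`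
  -- never equals `k`.
  S-total-shift : ∀ n k j →
    S n (+ k ℤ.- + j) ≈ᶜ total 0# n (λ i → ∑ℂ.δ k (j ℕ.+ i))
  S-total-shift n k j with j ℕ.≤? k
  ... | yes j≤k = begin
    S n (+ k ℤ.- + j)
      ≡⟨ ≡.cong (S n) (≡.trans (ℤ.m-n≡m⊖n k j) (ℤ.⊖-≥ j≤k)) ⟩
    S n (+ (k ∸ j))
      ≈⟨ S-total n (k ∸ j) ⟩
    total 0# n (∑ℂ.δ (k ∸ j))
      ≈⟨ total-cong 0# n (λ i _ → ℂ.reflexive (≡.trans
           (≡.sym (∑ℂ.δ-+ j (k ∸ j) i))
           (≡.cong (λ l → ∑ℂ.δ l (j ℕ.+ i)) (ℕ.m+[n∸m]≡n j≤k)))) ⟩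
    total 0# n (λ i → ∑ℂ.δ k (j ℕ.+ i)) ∎
    where open SetoidReasoning ℂ.setoid
  ... | no j≰k = begin
    S n (+ k ℤ.- + j)
      ≡⟨ ≡.cong (S n) (≡.trans (ℤ.m-n≡m⊖n k j) (ℤ.⊖-≰ j≰k)) ⟩
    S n (ℤ.- + (j ∸ k))
      -- Written as a successor, the positive `j ∸ k` gives an index of the form `-[1+ _ ]`, at
      -- which `S` is 0 by definition.
      ≡⟨ ≡.cong (λ i → S n (ℤ.- + i)) (ℕ.suc-pred (j ∸ k)
           {{ℕ.>-nonZero (ℕ.m<n⇒0<n∸m (ℕ.≰⇒> j≰k))}}) ⟨
    0ᶜ
      ≈⟨ total-0 0# n ⟨
    total 0# n (λ _ → 0ᶜ)
      ≈⟨ total-cong 0# n (λ i _ → ∑ℂ.δ-≢ (ℕ.<⇒≢ (ℕ.<-≤-trans (ℕ.≰⇒> j≰k) (ℕ.m≤m+n j i)))) ⟨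
    total 0# n (λ i → ∑ℂ.δ k (j ℕ.+ i)) ∎
    where open SetoidReasoning ℂ.setoid

  B-total : ∀ n → B n ≈ᶜ total 0# n (λ _ → 1ᶜ)
  B-total n = begin
    (∑[ k ∈ upTo (suc n) ] S n (+ k))
      ≈⟨ ∑ℂ.∑-cong (upTo (suc n)) (λ {k} _ → ℂ.trans (S-total n k) (ℂ.sym (ℂ.*-identityʳ _))) ⟩
    (∑[ k ∈ upTo (suc n) ] total 0# n (∑ℂ.δ k) *ᶜ 1ᶜ)
      ≈⟨ total-δ 0# n (λ _ → 1ᶜ) ⟨
    total 0# n (λ _ → 1ᶜ) ∎
    where open SetoidReasoning ℂ.setoid

  S-> : ∀ {n k} → n ℕ.< k → S n (+ k) ≈ᶜ 0ᶜ
  S-> {n} {k} n<k = ℂ.reflexive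
    (≡.cong (λ b → if b then (∑[ ψ ∈ C* n (n ∸ k) ] ω ψ) else 0ᶜ)
      (dec-false (k ℕ.≤? n) (ℕ.<⇒≱ n<k)))

-- The recurrence and convolution identities.

module Recurrences
  (ℝ : RealNumbers c ℓ) (power : RealPower ℝ)
  (s : RealNumbers.Carrier ℝ) (h : Complex.ℂ ℝ) (q : RealNumbers.Carrier ℝ)
  (0<q : RealNumbers._<_ ℝ (RealNumbers.0# ℝ) q)
  where

  open RealNumbers ℝ hiding (zero)
  open RealPower power
  open Complex ℝ
  open BigOperators complexRing
  open Gaussian commutativeRing using (gaussian)
  open RookNumbers ℝ power s h q
  open RookNumberProperties ℝ power s h q 0<q
  private
    module ℂ = CommutativeRing complexRing
    module ∑ℂ = BigOperatorProperties complexRing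
  open SetoidReasoning ℂ.setoid

  -- Common source of the first two identities: `w = δ (suc k)` with `f r = S r (+ k)`, and `w = 1`
  -- with `f = B`. The transport along `d` replaces `n ∸ r` by `suc n ∸ r ∸ 1`, the form in which
  -- the theorem has it.
  recurrence : ∀ n w (f : ℕ → ℂ) → (∀ r → f r ≈ᶜ total 0# r (w ∘ suc)) →
    total 0# (suc n) w ≈ᶜ
      (∑[ r ∈ upTo (suc n) ]
        h ^ᶜ (suc n ∸ r ∸ 1) *ᶜ ι (q ^ fromℕ r) *ᶜ ι (gaussian (q ^ s) n r)
        *ᶜ f r
        *ᶜ (∏[ i ∈ upTo (suc n ∸ r ∸ 1) ] ι [ 1# + s * fromℕ i ]q))
  recurrence n w f f≈ = ℂ.trans (total-recurrence n w)
    (∑ℂ.∑-cong (upTo (suc n)) (λ {r} _ → ≡.subst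
      (λ d →
        h ^ᶜ (n ∸ r) *ᶜ E (fromℕ r) *ᶜ Gaussian.gaussian complexRing (E s) n r
        *ᶜ total 0# r (w ∘ suc)
        *ᶜ (∏[ i ∈ upTo (n ∸ r) ] Q (1# + s * fromℕ i))
        ≈ᶜ
        h ^ᶜ d *ᶜ ι (q ^ fromℕ r) *ᶜ ι (gaussian (q ^ s) n r)
        *ᶜ f r
        *ᶜ (∏[ i ∈ upTo d ] ι [ 1# + s * fromℕ i ]q))
      (≡.sym (≡.trans (ℕ.∸-+-assoc (suc n) r 1) (≡.cong (suc n ∸_) (ℕ.+-comm r 1))))
      (ℂ.*-congʳ {∏[ i ∈ upTo (n ∸ r) ] Q (1# + s * fromℕ i)} (ℂ.*-cong
        (ℂ.*-congˡ {h ^ᶜ (n ∸ r) *ᶜ E (fromℕ r)} (ℂ.sym (ι-gaussian (q ^ s) n r)))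
        (ℂ.sym (f≈ r))))))

  -- Common source of the last two identities. The weight `δ k`, shifted by `j`, yields
  -- `S r (+ k ℤ.- + j)`; the constant weight 1 is unchanged by the shift and yields `B r`.
  convolution : ∀ n m w (f : ℕ → ℕ → ℂ) →
    (∀ r j → f r j ≈ᶜ total 0# r (λ k → w (j ℕ.+ k))) →
    total 0# (n ℕ.+ m) w ≈ᶜ
      (∑[ r ∈ upTo (suc n) ] ∑[ j ∈ upTo (suc m) ]
        h ^ᶜ (n ∸ r) *ᶜ ι (q ^ (fromℕ r * e j m)) *ᶜ ι (gaussian (q ^ s) n r)
        *ᶜ S m (+ j) *ᶜ f r j
        *ᶜ (∏[ i ∈ upTo (n ∸ r) ] ι [ e j m + s * fromℕ i ]q))
  convolution n m w f f≈ = ℂ.trans (total-convolution n m w)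
    (∑ℂ.∑-cong (upTo (suc n)) (λ {r} _ → ∑ℂ.∑-cong (upTo (suc m)) (λ {j} _ →
      ℂ.*-congʳ {∏[ i ∈ upTo (n ∸ r) ] Q (e j m + s * fromℕ i)} (ℂ.*-cong
        (ℂ.*-cong
          (ℂ.*-congˡ {h ^ᶜ (n ∸ r) *ᶜ E (fromℕ r * e j m)}
            (ℂ.sym (ι-gaussian (q ^ s) n r)))
          (ℂ.sym (S-total m j)))
        (ℂ.sym (f≈ r j))))))

  S-recurrence : ∀ n k → 1 ℕ.≤ n → 1 ℕ.≤ k →
    S n (+ k) ≈ᶜ
      (∑[ r ∈ range (k ∸ 1) n ]
        h ^ᶜ (n ∸ r ∸ 1) *ᶜ ι (q ^ fromℕ r) *ᶜ ι (gaussian (q ^ s) (n ∸ 1) r)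
        *ᶜ S r (+ (k ∸ 1))
        *ᶜ (∏[ i ∈ upTo (n ∸ r ∸ 1) ] ι [ 1# + s * fromℕ i ]q))
  S-recurrence (suc n) (suc k) _ _ = ℂ.trans (S-total (suc n) (suc k)) (ℂ.trans
    (recurrence n (∑ℂ.δ (suc k)) (λ r → S r (+ k)) (λ r → S-total r k))
    -- The terms with `r < k` contain `S r (+ k)`, which is 0.
    (ℂ.sym (∑ℂ.∑-range _ k (suc n) (λ r r<k → ℂ.trans
      (ℂ.*-congʳ {∏[ i ∈ upTo (suc n ∸ r ∸ 1) ] ι [ 1# + s * fromℕ i ]q} (ℂ.trans
        (ℂ.*-congˡ {h ^ᶜ (suc n ∸ r ∸ 1) *ᶜ ι (q ^ fromℕ r) *ᶜ ι (gaussian (q ^ s) n r)}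
          (S-> r<k))
        (ℂ.zeroʳ _)))
      (ℂ.zeroˡ _)))))

  B-recurrence : ∀ n → 1 ℕ.≤ n →
    B n ≈ᶜ
      (∑[ r ∈ upTo n ]
        h ^ᶜ (n ∸ r ∸ 1) *ᶜ ι (q ^ fromℕ r) *ᶜ ι (gaussian (q ^ s) (n ∸ 1) r)
        *ᶜ B r
        *ᶜ (∏[ i ∈ upTo (n ∸ r ∸ 1) ] ι [ 1# + s * fromℕ i ]q))
  B-recurrence (suc n) _ =
    ℂ.trans (B-total (suc n)) (recurrence n (λ _ → 1ᶜ) B B-total)

mainTheorem20 :
    ∀ {c ℓ} (ℝ : RealNumbers c ℓ) (power : RealPower ℝ) →
    let open RealNumbers ℝ
        open RealPower power
        open Complex ℝ
        open BigOperators complexRing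
        open Gaussian commutativeRing using (gaussian)
    in
    (s : Carrier) (h : ℂ) (q : Carrier) → ¬ (h ≈ᶜ 0ᶜ) → 0# < q →
    let open RookNumbers ℝ power s h q
        -- j (1 - s) + s m
        e : ℕ → ℕ → Carrier
        e j m = fromℕ j * (1# - s) + s * fromℕ m
    in
      (∀ n k → 1 ℕ.≤ n → 1 ℕ.≤ k →
        S n (+ k) ≈ᶜ
          (∑[ r ∈ range (k ∸ 1) n ]
            h ^ᶜ (n ∸ r ∸ 1) *ᶜ ι (q ^ fromℕ r) *ᶜ ι (gaussian (q ^ s) (n ∸ 1) r)
            *ᶜ S r (+ (k ∸ 1))
            *ᶜ (∏[ i ∈ upTo (n ∸ r ∸ 1) ] ι [ 1# + s * fromℕ i ]q)))
    × (∀ n → 1 ℕ.≤ n →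
        B n ≈ᶜ
          (∑[ r ∈ upTo n ]
            h ^ᶜ (n ∸ r ∸ 1) *ᶜ ι (q ^ fromℕ r) *ᶜ ι (gaussian (q ^ s) (n ∸ 1) r)
            *ᶜ B r
            *ᶜ (∏[ i ∈ upTo (n ∸ r ∸ 1) ] ι [ 1# + s * fromℕ i ]q)))
    × (∀ n m k →
        S (n ℕ.+ m) (+ k) ≈ᶜ
          (∑[ r ∈ upTo (suc n) ] ∑[ j ∈ upTo (suc m) ]
            h ^ᶜ (n ∸ r) *ᶜ ι (q ^ (fromℕ r * e j m)) *ᶜ ι (gaussian (q ^ s) n r)
            *ᶜ S m (+ j) *ᶜ S r (+ k ℤ.- + j)
            *ᶜ (∏[ i ∈ upTo (n ∸ r) ] ι [ e j m + s * fromℕ i ]q)))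
    × (∀ n m →
        B (n ℕ.+ m) ≈ᶜ
          (∑[ r ∈ upTo (suc n) ] ∑[ j ∈ upTo (suc m) ]
            h ^ᶜ (n ∸ r) *ᶜ ι (q ^ (fromℕ r * e j m)) *ᶜ ι (gaussian (q ^ s) n r)
            *ᶜ S m (+ j) *ᶜ B r
            *ᶜ (∏[ i ∈ upTo (n ∸ r) ] ι [ e j m + s * fromℕ i ]q)))
mainTheorem20 ℝ power s h q _ 0<q =
  S-recurrence ,
  B-recurrence ,
  (λ n m k → ≈-trans (S-total (n ℕ.+ m) k)
    (convolution n m (δ k) (λ r j → S r (+ k ℤ.- + j))
      (λ r j → S-total-shift r k j))) ,
  (λ n m → ≈-trans (B-total (n ℕ.+ m))
    (convolution n m (λ _ → 1ᶜ) (λ r j → B r) (λ r j → B-total r)))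
  where
  open Complex ℝ using (complexRing; 1ᶜ)
  open RookNumbers ℝ power s h q using (S; B)
  open BigOperatorProperties complexRing using (δ)
  open CommutativeRing complexRing using () renaming (trans to ≈-trans)
  open RookNumberProperties ℝ power s h q 0<q using (S-total; S-total-shift; B-total)
  open Recurrences ℝ power s h q 0<q
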